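{- Let $q$ be an odd prime power, let $p=\operatorname{char}\mathbb F_q$, and let $d\ge1$. The standard quadratic space $(\mathbb F_q^d,\ Q(x)=x_1^2+\cdots+x_d^2)$ contains a $(d+2)$-point equilateral set with nonzero common squared distance if and only if $$p\mid d+2\qquad\text{and}\qquad\bigl(d\text{ is odd or }q\equiv1\pmod 4\bigr).$$
   Context: A set of points $P_0,\ldots,P_{n-1}\in\mathbb F_q^d$ is equilateral with nonzero common squared distance if there is $\Delta\in\mathbb F_q^*$ such that $Q(P_i-P_j)=\Delta$ for all $i\neq j$. -}

module Defs where

open import Algebra.Apartness.Bundles using (HeytingCommutativeRing; HeytingField)
open import Algebra.Bundles using (CommutativeRing; Semiring)
import Algebra.Definitions.RawSemiring as RawSemiringDefinitions
open import Data.Fin.Base using (Fin)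
open import Data.Nat.Base as ℕ using (ℕ)
open import Data.Nat.Divisibility using (_∣_)
open import Data.Nat.Primality using (Prime)
open import Data.Product.Base using (∃-syntax; _×_)
open import Data.Vec.Functional using (Vector; zipWith)
open import Function.Bundles using (Inverse; _⇔_)
open import Level using (Level; _⊔_)
open import Relation.Binary.PropositionalEquality.Core using (_≡_; _≢_)
open import Relation.Binary.PropositionalEquality.Properties using (setoid)
open import Relation.Nullary.Negation.Core using (¬_)

Odd : ℕ → Set
Odd n = ¬ 2 ∣ n

IsPrimePower : ℕ → Set
IsPrimePower n = ∃[ p ] ∃[ k ] Prime p × 1 ℕ.≤ k × n ≡ p ℕ.^ k

-- Any finite field, with inverses demanded only of nonzero elements, is a
-- Heyting field with x # y taken to be ¬ (x ≈ y).  Conversely, on a Heyting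
-- field in bijection with some Fin q, both _≈_ and invertibility are
-- decidable, so _#_ coincides with ¬ (x ≈ y).  Hence Heyting fields with
-- HasCardinality q are exactly the fields with q elements.
module OverField {c ℓ₁ ℓ₂ : Level} (F : HeytingField c ℓ₁ ℓ₂) where

  commutativeRing : CommutativeRing c ℓ₁
  commutativeRing =
    HeytingCommutativeRing.commutativeRing (HeytingField.heytingCommutativeRing F)

  module R = CommutativeRing commutativeRing
  module D = RawSemiringDefinitions (Semiring.rawSemiring R.semiring)

  open R using (Carrier; _≈_; _≉_; _-_; 0#; 1#)

  HasCardinality : ℕ → Set (c ⊔ ℓ₁)
  HasCardinality q = Inverse R.setoid (setoid (Fin q))

  -- The kernel of ℤ → F, read on ℕ, consists of the multiples of p.
  -- Here n D.× 1# is the n-fold sum 1# + ⋯ + 1#.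
  HasCharacteristic : ℕ → Set ℓ₁
  HasCharacteristic p = ∀ n → (n D.× 1# ≈ 0#) ⇔ (p ∣ n)

  Point : ℕ → Set c
  Point d = Vector Carrier d

  Q : ∀ {d} → Point d → Carrier
  Q x = D.sum (λ k → x k D.^ 2)

  _-ᵖ_ : ∀ {d} → Point d → Point d → Point d
  _-ᵖ_ = zipWith _-_

  -- The nonzero common squared distance forces the n points to be pairwise
  -- distinct, so such a family is the same as an n-point set.
  IsEquilateral : ∀ {d n} → (Fin n → Point d) → Set (c ⊔ ℓ₁)
  IsEquilateral P =
    ∃[ Δ ] Δ ≉ 0# × (∀ i j → i ≢ j → Q (P i -ᵖ P j) ≈ Δ)

  ContainsEquilateral : (d n : ℕ) → Set (c ⊔ ℓ₁)
  ContainsEquilateral d n = ∃[ P ] IsEquilateral {d} {n} P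

{-# OPTIONS --safe #-}
-- Lifting x ∈ Fᵈ at scale C to f(x) = (x, y, z) with y + z = 1 and
-- y - z = C - Q(x) turns d + 2 points with common squared distance 2C into
-- d + 2 orthogonal vectors of norm C in the (d + 2)-dimensional space
-- Fᵈ ⊥ ⟨1⟩ ⊥ ⟨-1⟩.  The isotropic vector pairing to 1 with all of them is
-- C⁻¹ ∑ fₖ, of norm (d + 2)/C; hence p ∣ d + 2.  If d is even, rotating pairs
-- of the fₖ by x, y with x² + y² = C⁻¹ makes them orthonormal, and Witt
-- cancellation leaves ⟨-1⟩ ≅ ⟨1⟩, so that -1 is a square.
--
-- Conversely, there are g₀, …, g_d in Fᵈ⁺¹ with gⱼ · gₖ = -δⱼₖ: multiples of
-- the standard basis by √-1, or, if d is odd, standard basis vectors rotated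
-- in pairs by x, y with x² + y² = -1.  In Fᵈ⁺¹ ⊥ ⟨-1⟩ the gₖ and the last basis
-- vector e are at squared distance -2 from each other, and all of them pair
-- to -1 with u + e, where u = ∑ gₖ has norm -(d + 1) = 1.  As u + e is
-- isotropic, adding multiples of it changes no distance; the multiples are
-- chosen so that the first and last coordinates become equal up to a common
-- sign, whereupon their contributions cancel and both can be dropped.
module Submission where

open import Defs
open import Algebra.Apartness.Bundles using (HeytingField)
open import Data.Nat.Base using (ℕ; _≤_; _%_)
open import Data.Nat.Divisibility using (_∣_)
open import Data.Product.Base using (_×_)
open import Data.Sum.Base using (_⊎_)
open import Function.Bundles using (_⇔_)
open import Relation.Binary.PropositionalEquality.Core using (_≡_)

open import Algebra.Bundles using (CommutativeRing)
import Algebra.Properties.CommutativeMonoid.Sum as ℕSum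
open import Algebra.Solver.Ring.AlmostCommutativeRing
  using (fromCommutativeRing; _-Raw-AlmostCommutative⟶_)
open import Data.Bool.Base using (if_then_else_)
open import Data.Fin.Base as Fin using (Fin; zero; suc; punchIn; punchOut)
import Data.Fin.Permutation as Perm
import Data.Fin.Properties as Finₚ
open import Data.Integer.Base as ℤ using (ℤ; +_; -[1+_]; _⊖_)
import Data.Integer.Properties as ℤₚ
import Data.Maybe.Base as Maybe
open import Data.Nat.Base as ℕ using (zero; suc)
open import Data.Nat.DivMod using ([m+kn]%n≡m%n)
open import Data.Nat.Divisibility using (divides; _∣?_; ∣m∣n⇒∣m+n; n∣n)
import Data.Nat.Properties as ℕₚ
open import Data.Nat.Solver using (module +-*-Solver)
open import Data.Product.Base using (∃; ∃-syntax; Σ-syntax; _,_; proj₁; proj₂)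
open import Data.Sum.Base as Sum using (inj₁; inj₂)
open import Data.Unit.Base using (tt)
open import Data.Vec.Functional using (Vector; _∷_; tail)
open import Function.Base using (_∘_)
open import Function.Bundles using (Inverse; Equivalence; mk⇔)
open import Level using (Level; _⊔_)
open import Relation.Binary.Definitions using (tri<; tri≈; tri>)
open import Relation.Binary.PropositionalEquality as ≡ using (_≢_)
open import Relation.Nullary.Decidable
  using (Dec; yes; no; does; map′; _×-dec_; dec⇒maybe)
open import Relation.Nullary.Negation using (¬_; contradiction)
open import Relation.Unary using (Pred; Decidable)
open import Relation.Unary.Properties using (U?)

-- The homomorphism from ℤ and a solver for polynomial identities with integer coefficients.

-- The solver cancels terms only when it can decide equality of
-- coefficients, hence integer coefficients rather than ring elements.
module IntegerSolver {c ℓ} (R : CommutativeRing c ℓ) where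
  open CommutativeRing R
  open import Algebra.Properties.Ring ring
  open import Algebra.Properties.AbelianGroup +-abelianGroup using (⁻¹-∙-comm)
  -- In this variant `1 · 1#` computes to `1#`, so that `:1` denotes `1#` itself and `1-homo` holds
  -- by `refl`.
  open import Algebra.Properties.Semiring.Mult.TCOptimised semiring
    using (1+×; ×-homo-+; ×1-homo-*) renaming (_×_ to _·_)
  open import Relation.Binary.Reasoning.Setoid setoid

  fromℤ : ℤ → Carrier
  fromℤ (+ n)    = n · 1#
  fromℤ -[1+ n ] = - (suc n · 1#)

  fromℤ-neg : ∀ i → fromℤ (ℤ.- i) ≈ - fromℤ i
  fromℤ-neg (+ zero)  = sym -0#≈0#
  fromℤ-neg (+ suc n) = refl
  fromℤ-neg -[1+ n ]  = sym (-‿involutive _)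

  fromℤ-⊖ : ∀ m n → fromℤ (m ⊖ n) ≈ m · 1# - n · 1#
  fromℤ-⊖ zero    zero    = sym (-‿inverseʳ 0#)
  fromℤ-⊖ zero    (suc n) = sym (+-identityˡ _)
  fromℤ-⊖ (suc m) zero    = sym (trans (+-congˡ -0#≈0#) (+-identityʳ _))
  fromℤ-⊖ (suc m) (suc n) = begin
    fromℤ (suc m ⊖ suc n)                ≡⟨ ≡.cong fromℤ (ℤₚ.[1+m]⊖[1+n]≡m⊖n m n) ⟩
    fromℤ (m ⊖ n)                        ≈⟨ fromℤ-⊖ m n ⟩
    m · 1# - n · 1#                      ≈⟨ +-congʳ (+-identityˡ _) ⟨
    0# + m · 1# - n · 1#                 ≈⟨ +-congʳ (+-congʳ (-‿inverseʳ 1#)) ⟨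
    1# - 1# + m · 1# - n · 1#            ≈⟨ +-congʳ (+-assoc _ _ _) ⟩
    1# + (- 1# + m · 1#) - n · 1#        ≈⟨ +-congʳ (+-congˡ (+-comm _ _)) ⟩
    1# + (m · 1# - 1#) - n · 1#          ≈⟨ +-congʳ (+-assoc _ _ _) ⟨
    1# + m · 1# - 1# - n · 1#            ≈⟨ +-assoc _ _ _ ⟩
    1# + m · 1# + (- 1# - n · 1#)
      ≈⟨ +-cong (sym (1+× m 1#)) (trans (⁻¹-∙-comm _ _) (-‿cong (sym (1+× n 1#)))) ⟩
    suc m · 1# - suc n · 1#              ∎

  fromℤ-+ : ∀ i j → fromℤ (i ℤ.+ j) ≈ fromℤ i + fromℤ j
  fromℤ-+ (+ m)    (+ n)    = ×-homo-+ 1# m n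
  fromℤ-+ (+ m)    -[1+ n ] = fromℤ-⊖ m (suc n)
  fromℤ-+ -[1+ m ] (+ n)    = trans (fromℤ-⊖ n (suc m)) (+-comm _ _)
  fromℤ-+ -[1+ m ] -[1+ n ] = begin
    - (suc (suc (m ℕ.+ n)) · 1#)         ≈⟨ -‿cong (·-congˡ (≡.cong suc (≡.sym (ℕₚ.+-suc m n)))) ⟩
    - ((suc m ℕ.+ suc n) · 1#)           ≈⟨ -‿cong (×-homo-+ 1# (suc m) (suc n)) ⟩
    - (suc m · 1# + suc n · 1#)          ≈⟨ ⁻¹-∙-comm _ _ ⟨
    - (suc m · 1#) - suc n · 1#          ∎
    where
    ·-congˡ : ∀ {k l} → k ≡ l → k · 1# ≈ l · 1#
    ·-congˡ ≡.refl = refl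

  fromℤ-*⁺ : ∀ m j → fromℤ (+ m ℤ.* j) ≈ fromℤ (+ m) * fromℤ j
  fromℤ-*⁺ m (+ n) = begin
    fromℤ (+ m ℤ.* + n)                  ≡⟨ ≡.cong fromℤ (ℤₚ.pos-* m n) ⟨
    (m ℕ.* n) · 1#                       ≈⟨ ×1-homo-* m n ⟩
    m · 1# * (n · 1#)                    ∎
  fromℤ-*⁺ m -[1+ n ] = begin
    fromℤ (+ m ℤ.* -[1+ n ])             ≡⟨ ≡.cong fromℤ (ℤₚ.neg-distribʳ-* (+ m) (+ suc n)) ⟨
    fromℤ (ℤ.- (+ m ℤ.* + suc n))        ≈⟨ fromℤ-neg (+ m ℤ.* + suc n) ⟩
    - fromℤ (+ m ℤ.* + suc n)            ≈⟨ -‿cong (fromℤ-*⁺ m (+ suc n)) ⟩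
    - (fromℤ (+ m) * fromℤ (+ suc n))    ≈⟨ -‿distribʳ-* _ _ ⟩
    fromℤ (+ m) * fromℤ -[1+ n ]         ∎

  fromℤ-* : ∀ i j → fromℤ (i ℤ.* j) ≈ fromℤ i * fromℤ j
  fromℤ-* (+ m)    j = fromℤ-*⁺ m j
  fromℤ-* -[1+ m ] j = begin
    fromℤ (-[1+ m ] ℤ.* j)               ≡⟨ ≡.cong fromℤ (ℤₚ.neg-distribˡ-* (+ suc m) j) ⟨
    fromℤ (ℤ.- (+ suc m ℤ.* j))          ≈⟨ fromℤ-neg (+ suc m ℤ.* j) ⟩
    - fromℤ (+ suc m ℤ.* j)              ≈⟨ -‿cong (fromℤ-*⁺ (suc m) j) ⟩
    - (fromℤ (+ suc m) * fromℤ j)        ≈⟨ -‿distribˡ-* _ _ ⟩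
    fromℤ -[1+ m ] * fromℤ j             ∎

  fromℤ-morphism : ℤ.+-*-rawRing -Raw-AlmostCommutative⟶ fromCommutativeRing R
  fromℤ-morphism = record
    { ⟦_⟧    = fromℤ
    ; +-homo = fromℤ-+
    ; *-homo = fromℤ-*
    ; -‿homo = fromℤ-neg
    ; 0-homo = refl
    ; 1-homo = refl
    }

  open import Algebra.Solver.Ring ℤ.+-*-rawRing (fromCommutativeRing R) fromℤ-morphism
    (λ i j → Maybe.map (λ i≡j → reflexive (≡.cong fromℤ i≡j)) (dec⇒maybe (i ℤₚ.≟ j)))
    public using (Polynomial; solve; _:=_; con; _:+_; _:*_; _:-_; :-_)

  :1 : ∀ {n} → Polynomial n
  :1 = con (+ 1)

  :0 : ∀ {n} → Polynomial n
  :0 = con (+ 0)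

-- Bilinear forms, orthogonal families and rotations of pairs.

module Forms {c ℓ} (R : CommutativeRing c ℓ) where
  open CommutativeRing R hiding (zero)
  open IntegerSolver R public
  open import Algebra.Properties.Semiring.Sum semiring public
  open import Relation.Binary.Reasoning.Setoid setoid

  dot : ∀ {n} → Vector Carrier n → Vector Carrier n → Carrier
  dot x y = sum (λ i → x i * y i)

  dot-comm : ∀ {n} (x y : Vector Carrier n) → dot x y ≈ dot y x
  dot-comm x y = sum-cong-≋ (λ i → *-comm (x i) (y i))

  dot-linˡ : ∀ {n} s t (x x′ y : Vector Carrier n) →
             dot (λ i → s * x i + t * x′ i) y ≈ s * dot x y + t * dot x′ y
  dot-linˡ s t x x′ y = begin
    sum (λ i → (s * x i + t * x′ i) * y i)
      ≈⟨ sum-cong-≋ (λ i → solve 5 (λ s t x x′ y → (s :* x :+ t :* x′) :* y :=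
           s :* (x :* y) :+ t :* (x′ :* y)) refl s t (x i) (x′ i) (y i)) ⟩
    sum (λ i → s * (x i * y i) + t * (x′ i * y i))
      ≈⟨ ∑-distrib-+ (λ i → s * (x i * y i)) (λ i → t * (x′ i * y i)) ⟩
    sum (λ i → s * (x i * y i)) + sum (λ i → t * (x′ i * y i))
      ≈⟨ +-cong (*-distribˡ-sum s (λ i → x i * y i)) (*-distribˡ-sum t (λ i → x′ i * y i)) ⟨
    s * dot x y + t * dot x′ y ∎

  dot-linʳ : ∀ {n} s t (x y y′ : Vector Carrier n) →
             dot x (λ i → s * y i + t * y′ i) ≈ s * dot x y + t * dot x y′
  dot-linʳ s t x y y′ = begin
    dot x (λ i → s * y i + t * y′ i)  ≈⟨ dot-comm x _ ⟩
    dot (λ i → s * y i + t * y′ i) x  ≈⟨ dot-linˡ s t y y′ x ⟩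
    s * dot y x + t * dot y′ x        ≈⟨ +-cong (*-congˡ (dot-comm y x)) (*-congˡ (dot-comm y′ x)) ⟩
    s * dot x y + t * dot x y′        ∎

  dot-lin : ∀ {n} s t s′ t′ (x y x′ y′ : Vector Carrier n) →
            dot (λ i → s * x i + t * y i) (λ i → s′ * x′ i + t′ * y′ i) ≈
            s * (s′ * dot x x′ + t′ * dot x y′) + t * (s′ * dot y x′ + t′ * dot y y′)
  dot-lin s t s′ t′ x y x′ y′ = trans
    (dot-linˡ s t x y (λ i → s′ * x′ i + t′ * y′ i))
    (+-cong (*-congˡ (dot-linʳ s′ t′ x x′ y′)) (*-congˡ (dot-linʳ s′ t′ y x′ y′)))

  -- The diagonal form ⟨b⟩ ⊥ ⟨1⟩ⁿ. The value b = -1 serves the lifted points and b = 1 the space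
  -- Fᵈ⁺¹ of the converse.
  form : ∀ {n} → Carrier → Vector Carrier (suc n) → Vector Carrier (suc n) → Carrier
  form b x y = b * (x zero * y zero) + dot (tail x) (tail y)

  form-comm : ∀ {n} b (x y : Vector Carrier (suc n)) → form b x y ≈ form b y x
  form-comm b x y = +-cong (*-congˡ (*-comm _ _)) (dot-comm (tail x) (tail y))

  form-congˡ : ∀ {n} b {x x′ : Vector Carrier (suc n)} y →
               (∀ i → x i ≈ x′ i) → form b x y ≈ form b x′ y
  form-congˡ b y x≋x′ =
    +-cong (*-congˡ (*-congʳ (x≋x′ zero))) (sum-cong-≋ (λ i → *-congʳ (x≋x′ (suc i))))

  form-linˡ : ∀ {n} b s t (x x′ y : Vector Carrier (suc n)) →
              form b (λ i → s * x i + t * x′ i) y ≈ s * form b x y + t * form b x′ y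
  form-linˡ b s t x x′ y = trans
    (+-congˡ (dot-linˡ s t (tail x) (tail x′) (tail y)))
    (solve 8 (λ b s t x x′ y d d′ → b :* ((s :* x :+ t :* x′) :* y) :+ (s :* d :+ t :* d′) :=
       s :* (b :* (x :* y) :+ d) :+ t :* (b :* (x′ :* y) :+ d′))
      refl b s t (x zero) (x′ zero) (y zero) (dot (tail x) (tail y)) (dot (tail x′) (tail y)))

  form-linʳ : ∀ {n} b s t (x y y′ : Vector Carrier (suc n)) →
              form b x (λ i → s * y i + t * y′ i) ≈ s * form b x y + t * form b x y′
  form-linʳ b s t x y y′ = begin
    form b x (λ i → s * y i + t * y′ i)  ≈⟨ form-comm b x (λ i → s * y i + t * y′ i) ⟩
    form b (λ i → s * y i + t * y′ i) x  ≈⟨ form-linˡ b s t y y′ x ⟩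
    s * form b y x + t * form b y′ x     ≈⟨ +-cong (*-congˡ (form-comm b y x)) (*-congˡ (form-comm b y′ x)) ⟩
    s * form b x y + t * form b x y′     ∎

  form-lin : ∀ {n} b s t s′ t′ (x y x′ y′ : Vector Carrier (suc n)) →
             form b (λ i → s * x i + t * y i) (λ i → s′ * x′ i + t′ * y′ i) ≈
             s * (s′ * form b x x′ + t′ * form b x y′) + t * (s′ * form b y x′ + t′ * form b y y′)
  form-lin b s t s′ t′ x y x′ y′ = trans
    (form-linˡ b s t x y (λ i → s′ * x′ i + t′ * y′ i))
    (+-cong (*-congˡ (form-linʳ b s′ t′ x x′ y′)) (*-congˡ (form-linʳ b s′ t′ y x′ y′)))

  form-zeroˡ : ∀ {n} b (y : Vector Carrier (suc n)) → form b (λ _ → 0#) y ≈ 0#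
  form-zeroˡ b y = begin
    form b (λ _ → 0#) y
      ≈⟨ form-congˡ b y (λ i → solve 1 (λ y → :0 := :0 :* y :+ :0 :* y) refl (y i)) ⟩
    form b (λ i → 0# * y i + 0# * y i) y       ≈⟨ form-linˡ b 0# 0# y y y ⟩
    0# * form b y y + 0# * form b y y          ≈⟨ solve 1 (λ f → :0 :* f :+ :0 :* f := :0) refl _ ⟩
    0#                                         ∎

  form-sumˡ : ∀ {m n} b (a : Vector Carrier m) (v : Fin m → Vector Carrier (suc n)) y →
              form b (λ i → sum (λ k → a k * v k i)) y ≈ sum (λ k → a k * form b (v k) y)
  form-sumˡ {zero}  b a v y = form-zeroˡ b y
  form-sumˡ {suc m} b a v y = begin
    form b (λ i → a zero * v zero i + rest i) y
      ≈⟨ form-congˡ b y (λ i → +-congˡ {a zero * v zero i} (sym (*-identityˡ (rest i)))) ⟩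
    form b (λ i → a zero * v zero i + 1# * rest i) y
      ≈⟨ form-linˡ b (a zero) 1# (v zero) rest y ⟩
    a zero * form b (v zero) y + 1# * form b rest y
      ≈⟨ +-congˡ (trans (*-identityˡ _) (form-sumˡ b (tail a) (tail v) y)) ⟩
    sum (λ k → a k * form b (v k) y) ∎
    where
    rest : Vector Carrier _
    rest i = sum (λ k → a (suc k) * v (suc k) i)

  δ : ∀ {n} → Fin n → Fin n → Carrier
  δ zero    zero    = 1#
  δ zero    (suc _) = 0#
  δ (suc _) zero    = 0#
  δ (suc j) (suc k) = δ j k

  δ-diag : ∀ {n} (j : Fin n) → δ j j ≡ 1#
  δ-diag zero    = ≡.refl
  δ-diag (suc j) = δ-diag j

  δ-off : ∀ {n} {j k : Fin n} → j ≢ k → δ j k ≡ 0#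
  δ-off {j = zero}  {zero}  j≢k = contradiction ≡.refl j≢k
  δ-off {j = zero}  {suc k} j≢k = ≡.refl
  δ-off {j = suc j} {zero}  j≢k = ≡.refl
  δ-off {j = suc j} {suc k} j≢k = δ-off (j≢k ∘ ≡.cong suc)

  dot-zeroʳ : ∀ {n} (x : Vector Carrier n) → dot x (λ _ → 0#) ≈ 0#
  dot-zeroʳ {n} x = trans (sum-cong-≋ (λ i → zeroʳ (x i))) (sum-replicate-zero n)

  dot-δ : ∀ {n} (x : Vector Carrier n) k → dot x (λ j → δ j k) ≈ x k
  dot-δ x zero    = trans (+-cong (*-identityʳ _) (dot-zeroʳ (tail x))) (+-identityʳ _)
  dot-δ x (suc k) = trans (+-cong (zeroʳ _) (dot-δ (tail x) k)) (+-identityˡ _)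

  OrthogonalOfNorm : ∀ {m n} → Carrier → Carrier → (Fin m → Vector Carrier (suc n)) → Set ℓ
  OrthogonalOfNorm b a f = ∀ j k → form b (f j) (f k) ≈ a * δ j k

  -- Block-diagonal action of the matrix with rows (r, s) and (-s, r), which is orthogonal up to the
  -- factor r² + s². Scaling vectors one at a time can multiply their norm only by a square; working
  -- in pairs allows any sum of two squares.
  rotatePairs : ∀ {n} m → Carrier → Carrier →
                (Fin (m ℕ.* 2) → Vector Carrier n) → Fin (m ℕ.* 2) → Vector Carrier n
  rotatePairs (suc m) r s f zero          i = r * f zero i + s * f (suc zero) i
  rotatePairs (suc m) r s f (suc zero)    i = (- s) * f zero i + r * f (suc zero) i
  rotatePairs (suc m) r s f (suc (suc j)) i = rotatePairs m r s (λ k → f (suc (suc k))) j i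

  lin-≈0 : ∀ r s {x y} → x ≈ 0# → y ≈ 0# → r * x + s * y ≈ 0#
  lin-≈0 r s x≈0 y≈0 = trans (+-cong (trans (*-congˡ x≈0) (zeroʳ r)) (trans (*-congˡ y≈0) (zeroʳ s)))
        (+-identityʳ 0#)

  -- Each rotated vector is a combination of two of the `f j`, so orthogonality to y is inherited.
  -- Taking y in the first pair separates that pair from all later ones.
  rotatePairs-⊥ : ∀ {n} b m r s (f : Fin (m ℕ.* 2) → Vector Carrier (suc n)) y →
                  (∀ j → form b (f j) y ≈ 0#) → ∀ j → form b (rotatePairs m r s f j) y ≈ 0#
  rotatePairs-⊥ b (suc m) r s f y f⊥y zero =
    trans (form-linˡ b r s (f zero) (f (suc zero)) y) (lin-≈0 r s (f⊥y zero) (f⊥y (suc zero)))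
  rotatePairs-⊥ b (suc m) r s f y f⊥y (suc zero) =
    trans (form-linˡ b (- s) r (f zero) (f (suc zero)) y) (lin-≈0 (- s) r (f⊥y zero) (f⊥y (suc zero)))
  rotatePairs-⊥ b (suc m) r s f y f⊥y (suc (suc j)) =
    rotatePairs-⊥ b m r s (λ k → f (suc (suc k))) y (λ k → f⊥y (suc (suc k))) j

  rotatePairs-orthogonal : ∀ {n} b a m r s (f : Fin (m ℕ.* 2) → Vector Carrier (suc n)) →
    OrthogonalOfNorm b a f → OrthogonalOfNorm b ((r * r + s * s) * a) (rotatePairs m r s f)
  rotatePairs-orthogonal b a (suc m) r s f f⊥ = go
    where
    f₀ = f zero
    f₁ = f (suc zero)
    f″ = λ k → f (suc (suc k))
    rotated = rotatePairs (suc m) r s f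
    N  = (r * r + s * s) * a
    f₀₀ : form b f₀ f₀ ≈ a
    f₀₀ = trans (f⊥ zero zero) (*-identityʳ a)
    f₁₁ : form b f₁ f₁ ≈ a
    f₁₁ = trans (f⊥ (suc zero) (suc zero)) (*-identityʳ a)
    f₀₁ : form b f₀ f₁ ≈ 0#
    f₀₁ = trans (f⊥ zero (suc zero)) (zeroʳ a)
    f₁₀ : form b f₁ f₀ ≈ 0#
    f₁₀ = trans (f⊥ (suc zero) zero) (zeroʳ a)
    block : ∀ s₁ t₁ s₂ t₂ →
            form b (λ i → s₁ * f₀ i + t₁ * f₁ i) (λ i → s₂ * f₀ i + t₂ * f₁ i) ≈ (s₁ * s₂ + t₁ * t₂) * a
    block s₁ t₁ s₂ t₂ = begin
      _ ≈⟨ form-lin b s₁ t₁ s₂ t₂ f₀ f₁ f₀ f₁ ⟩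
      _ ≈⟨ +-cong (*-congˡ (+-cong (*-congˡ f₀₀) (*-congˡ f₀₁)))
            (*-congˡ (+-cong (*-congˡ f₁₀) (*-congˡ f₁₁))) ⟩
      s₁ * (s₂ * a + t₂ * 0#) + t₁ * (s₂ * 0# + t₂ * a)
        ≈⟨ +-cong (*-congˡ (trans (+-congˡ (zeroʳ t₂)) (+-identityʳ _)))
              (*-congˡ (trans (+-congʳ (zeroʳ s₂)) (+-identityˡ _))) ⟩
      s₁ * (s₂ * a) + t₁ * (t₂ * a)
        ≈⟨ solve 5 (λ s₁ t₁ s₂ t₂ a → s₁ :* (s₂ :* a) :+ t₁ :* (t₂ :* a) := (s₁ :* s₂ :+ t₁ :* t₂) :* a)
             refl s₁ t₁ s₂ t₂ a ⟩
      (s₁ * s₂ + t₁ * t₂) * a ∎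
    tail⊥₀ : ∀ j → form b (f″ j) f₀ ≈ 0#
    tail⊥₀ j = trans (f⊥ (suc (suc j)) zero) (zeroʳ a)
    tail⊥₁ : ∀ j → form b (f″ j) f₁ ≈ 0#
    tail⊥₁ j = trans (f⊥ (suc (suc j)) (suc zero)) (zeroʳ a)
    cross : ∀ s′ t′ j → form b (rotatePairs m r s f″ j) (λ i → s′ * f₀ i + t′ * f₁ i) ≈ N * 0#
    cross s′ t′ j = begin
      _  ≈⟨ form-linʳ b s′ t′ (rotatePairs m r s f″ j) f₀ f₁ ⟩
      _  ≈⟨ lin-≈0 s′ t′ (rotatePairs-⊥ b m r s f″ f₀ tail⊥₀ j) (rotatePairs-⊥ b m r s f″ f₁ tail⊥₁ j) ⟩
      0# ≈⟨ zeroʳ N ⟨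
      N * 0# ∎
    go : OrthogonalOfNorm b N (rotatePairs (suc m) r s f)
    go zero zero = trans (block r s r s) (sym (*-identityʳ N))
    go zero (suc zero) = trans (block r s (- s) r)
      (trans (solve 3 (λ r s a → (r :* (:- s) :+ s :* r) :* a := :0) refl r s a) (sym (zeroʳ N)))
    go (suc zero) zero = trans (form-comm b (rotated (suc zero)) (rotated zero)) (go zero (suc zero))
    go (suc zero) (suc zero) = trans (block (- s) r (- s) r)
      (trans (solve 3 (λ r s a → ((:- s) :* (:- s) :+ r :* r) :* a := (r :* r :+ s :* s) :* a)
           refl r s a) (sym (*-identityʳ N)))
    go zero (suc (suc k)) = trans (form-comm b (rotated zero) (rotated (suc (suc k)))) (cross r s k)
    go (suc zero) (suc (suc k)) = trans (form-comm b (rotated (suc zero)) (rotated (suc (suc k))))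
          (cross (- s) r k)
    go (suc (suc j)) zero = cross r s j
    go (suc (suc j)) (suc zero) = cross (- s) r j
    go (suc (suc j)) (suc (suc k)) =
      rotatePairs-orthogonal b a m r s f″ (λ j k → f⊥ (suc (suc j)) (suc (suc k))) j k

-- Linear algebra over fields in which every element is zero or invertible.

record IsDiscreteField {c ℓ} (R : CommutativeRing c ℓ) : Set (c ⊔ ℓ) where
  open CommutativeRing R hiding (zero)
  field
    1≉0       : 1# ≉ 0#
    -- Elimination finds its pivots by testing entries for zero, so the axiom is asked for in
    -- decidable form. A search through the finite field will provide it.
    zero⊎unit : ∀ x → x ≈ 0# ⊎ ∃[ y ] y * x ≈ 1#

module DiscreteField {c ℓ} (R : CommutativeRing c ℓ) (isDiscreteField : IsDiscreteField R) where

  open CommutativeRing R hiding (zero)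
  open IsDiscreteField isDiscreteField public
  open Forms R public
  open import Algebra.Properties.Ring ring public using (-0#≈0#; -‿involutive; x∙y⁻¹≈ε⇒x≈y; x≈y⇒x∙y⁻¹≈ε)
  open import Relation.Binary.Reasoning.Setoid setoid

  inverse : ∀ {x} → x ≉ 0# → ∃[ y ] y * x ≈ 1#
  inverse {x} x≉0 with zero⊎unit x
  ... | inj₁ x≈0 = contradiction x≈0 x≉0
  ... | inj₂ inv = inv

  xy≈0⇒x≈0⊎y≈0 : ∀ x y → x * y ≈ 0# → x ≈ 0# ⊎ y ≈ 0#
  xy≈0⇒x≈0⊎y≈0 x y xy≈0 with zero⊎unit x
  ... | inj₁ x≈0          = inj₁ x≈0
  ... | inj₂ (z , zx≈1) = inj₂ (begin
    y           ≈⟨ *-identityˡ y ⟨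
    1# * y      ≈⟨ *-congʳ zx≈1 ⟨
    z * x * y   ≈⟨ *-assoc z x y ⟩
    z * (x * y) ≈⟨ *-congˡ xy≈0 ⟩
    z * 0#      ≈⟨ zeroʳ z ⟩
    0#          ∎)

  x≉0∧xy≈0⇒y≈0 : ∀ {x y} → x ≉ 0# → x * y ≈ 0# → y ≈ 0#
  x≉0∧xy≈0⇒y≈0 {x} {y} x≉0 xy≈0 with xy≈0⇒x≈0⊎y≈0 x y xy≈0
  ... | inj₁ x≈0 = contradiction x≈0 x≉0
  ... | inj₂ y≈0 = y≈0

  x²≈y²⇒x≈±y : ∀ x y → x * x ≈ y * y → x ≈ y ⊎ x ≈ - y
  x²≈y²⇒x≈±y x y x²≈y² with xy≈0⇒x≈0⊎y≈0 (x - y) (x + y) (begin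
    (x - y) * (x + y) ≈⟨ solve 2 (λ x y → (x :- y) :* (x :+ y) := x :* x :- y :* y) refl x y ⟩
    x * x - y * y     ≈⟨ x≈y⇒x∙y⁻¹≈ε x²≈y² ⟩
    0#                ∎)
  ... | inj₁ x-y≈0 = inj₁ (x∙y⁻¹≈ε⇒x≈y x y x-y≈0)
  ... | inj₂ x+y≈0 = inj₂ (begin
    x         ≈⟨ solve 2 (λ x y → x := x :+ y :- y) refl x y ⟩
    x + y - y ≈⟨ +-congʳ x+y≈0 ⟩
    0# - y    ≈⟨ +-identityˡ (- y) ⟩
    - y       ∎)

  -1≉0 : - 1# ≉ 0#
  -1≉0 -1≈0 = 1≉0 (trans (sym (-‿involutive 1#)) (trans (-‿cong -1≈0) -0#≈0#))

  inverse-unique : ∀ {x y z} → y * x ≈ 1# → z * x ≈ 1# → y ≈ z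
  inverse-unique {x} {y} {z} yx≈1 zx≈1 = begin
    y            ≈⟨ *-identityʳ y ⟨
    y * 1#       ≈⟨ *-congˡ zx≈1 ⟨
    y * (z * x)  ≈⟨ solve 3 (λ x y z → y :* (z :* x) := z :* (y :* x)) refl x y z ⟩
    z * (y * x)  ≈⟨ *-congˡ yx≈1 ⟩
    z * 1#       ≈⟨ *-identityʳ z ⟩
    z            ∎

  Dependent : ∀ {m n} → (Fin m → Vector Carrier n) → Set (c ⊔ ℓ)
  Dependent {m} v = Σ[ a ∈ Vector Carrier m ] (∃[ k ] a k ≉ 0#) × ∀ i → sum (λ k → a k * v k i) ≈ 0#

  allZero⊎unit : ∀ {n} (x : Vector Carrier n) →
                 (∀ i → x i ≈ 0#) ⊎ ∃[ i ] ∃[ y ] y * x i ≈ 1#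
  allZero⊎unit {zero}  x = inj₁ λ ()
  allZero⊎unit {suc n} x with zero⊎unit (x zero)
  ... | inj₂ unit = inj₂ (zero , unit)
  ... | inj₁ x₀≈0 with allZero⊎unit (tail x)
  ...   | inj₁ rest≈0     = inj₁ λ { zero → x₀≈0 ; (suc i) → rest≈0 i }
  ...   | inj₂ (i , unit) = inj₂ (suc i , unit)

  -- Gaussian elimination. If v₀ = 0, it is a relation by itself. Otherwise v₀ has an invertible
  -- entry at some p; multiples of v₀ clear coordinate p of the other vectors, and the recursion
  -- runs on the remaining coordinates.
  1+n-vectors-dependent : ∀ n (v : Fin (suc n) → Vector Carrier n) → Dependent v
  1+n-vectors-dependent zero v = (λ _ → 1#) , (zero , 1≉0) , λ ()
  1+n-vectors-dependent (suc n) v with allZero⊎unit (v zero)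
  ... | inj₁ v₀≈0 = δ zero , (zero , 1≉0) , λ i → begin
    1# * v zero i + sum (λ k → 0# * v (suc k) i)
      ≈⟨ +-cong (trans (*-identityˡ _) (v₀≈0 i))
            (trans (sum-cong-≋ (λ k → zeroˡ (v (suc k) i))) (sum-replicate-zero (suc n))) ⟩
    0# + 0#  ≈⟨ +-identityʳ 0# ⟩
    0#       ∎
  ... | inj₂ (p , y , yv₀p≈1) = a , (suc k , a′k≉0) , vanishes
    where
    reduced : Fin (suc n) → Vector Carrier (suc n)
    reduced k i = v (suc k) i - v (suc k) p * y * v zero i
    reducedDependent : Dependent (λ k i → reduced k (punchIn p i))
    reducedDependent = 1+n-vectors-dependent n (λ k i → reduced k (punchIn p i))
    a′ : Vector Carrier (suc n)
    a′ = proj₁ reducedDependent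
    k : Fin (suc n)
    k = proj₁ (proj₁ (proj₂ reducedDependent))
    a′k≉0 : a′ k ≉ 0#
    a′k≉0 = proj₂ (proj₁ (proj₂ reducedDependent))
    -- Each reduced vector has lost a multiple of v₀; `a₀` collects these multiples, so that a
    -- relation among the reduced vectors becomes one among the original ones.
    a₀ : Carrier
    a₀ = sum (λ k → a′ k * (v (suc k) p * y))
    a : Vector Carrier (suc (suc n))
    a = - a₀ ∷ a′
    regroup : ∀ i → sum (λ k → a k * v k i) ≈ sum (λ k → a′ k * reduced k i)
    regroup i = sym (begin
      sum (λ k → a′ k * reduced k i)
        ≈⟨ sum-cong-≋ (λ k → solve 4 (λ a x z w → a :* (x :- z :* w) := (:- w) :* (a :* z) :+ a :* x)
             refl (a′ k) (v (suc k) i) (v (suc k) p * y) (v zero i)) ⟩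
      sum (λ k → - v zero i * (a′ k * (v (suc k) p * y)) + a′ k * v (suc k) i)
        ≈⟨ ∑-distrib-+ (λ k → - v zero i * (a′ k * (v (suc k) p * y))) (λ k → a′ k * v (suc k) i) ⟩
      sum (λ k → - v zero i * (a′ k * (v (suc k) p * y))) + rest
        ≈⟨ +-congʳ (*-distribˡ-sum (- v zero i) (λ k → a′ k * (v (suc k) p * y))) ⟨
      - v zero i * a₀ + rest
        ≈⟨ +-congʳ (solve 2 (λ w a₀ → (:- w) :* a₀ := (:- a₀) :* w) refl (v zero i) a₀) ⟩
      - a₀ * v zero i + rest ∎)
      where
      rest = sum (λ k → a′ k * v (suc k) i)
    reduced-p≈0 : ∀ k → a′ k * reduced k p ≈ 0#
    reduced-p≈0 k = begin
      a′ k * (v (suc k) p - v (suc k) p * y * v zero p)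
        ≈⟨ solve 4 (λ a x y w → a :* (x :- x :* y :* w) := a :* x :* (:1 :- y :* w))
             refl (a′ k) (v (suc k) p) y (v zero p) ⟩
      a′ k * v (suc k) p * (1# - y * v zero p)
        ≈⟨ *-congˡ (x≈y⇒x∙y⁻¹≈ε (sym yv₀p≈1)) ⟩
      a′ k * v (suc k) p * 0#
        ≈⟨ zeroʳ _ ⟩
      0# ∎
    vanishes : ∀ i → sum (λ k → a k * v k i) ≈ 0#
    -- All reduced vectors vanish at the pivot coordinate; every other coordinate is covered by the
    -- recursion.
    vanishes i with p Finₚ.≟ i
    ... | yes ≡.refl = trans (regroup i) (trans (sum-cong-≋ reduced-p≈0) (sum-replicate-zero (suc n)))
    ... | no p≢i     = ≡.subst (λ i → sum (λ k → a k * v k i) ≈ 0#) (Finₚ.punchIn-punchOut p≢i)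
      (trans (regroup (punchIn p (punchOut p≢i))) (proj₂ (proj₂ reducedDependent) (punchOut p≢i)))

  module _ (1+1≉0 : 1# + 1# ≉ 0#) where

    -- Since 1 and -1 differ by 2 ≠ 0, they cannot both equal u. The scalar μ inverts the difference
    -- for the sign that does not.
    signAway : ∀ u → ∃[ ε ] ∃[ μ ] ε * ε ≈ 1# × μ * (ε - u) ≈ 1#
    signAway u with zero⊎unit (1# - u) | zero⊎unit (- 1# - u)
    ... | inj₂ (μ , μ[1-u]≈1) | _ = 1# , μ , *-identityʳ 1# , μ[1-u]≈1
    ... | inj₁ _ | inj₂ (μ , μ[-1-u]≈1) = - 1# , μ , solve 0 ((:- :1) :* (:- :1) := :1) refl , μ[-1-u]≈1
    ... | inj₁ 1-u≈0 | inj₁ -1-u≈0 = contradiction (begin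
      1# + 1#                ≈⟨ solve 1 (λ u → :1 :+ :1 := (:1 :- u) :- (:- :1 :- u)) refl u ⟩
      (1# - u) - (- 1# - u)  ≈⟨ x≈y⇒x∙y⁻¹≈ε (trans 1-u≈0 (sym -1-u≈0)) ⟩
      0#                     ∎) 1+1≉0

    -- Witt cancellation of the unit coordinates.  The vector f₀ is made to
    -- play the rôle of a unit basis vector: adding to each remaining vector
    -- the multiple of f₀ that an isometry taking f₀ to ± that basis vector
    -- would add leaves an orthonormal family with one coordinate fewer.
    orthonormal⇒square : ∀ {n} b (f : Fin (suc n) → Vector Carrier (suc n)) →
                         OrthogonalOfNorm b 1# f → ∃[ r ] r * r ≈ b
    -- In dimension one the single entry satisfies b z² = 1, whence (b z)² = b.
    orthonormal⇒square {zero} b f f⊥ = b * z , (begin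
      (b * z) * (b * z)
        ≈⟨ solve 2 (λ b z → (b :* z) :* (b :* z) := b :* (b :* (z :* z) :+ :0)) refl b z ⟩
      b * (b * (z * z) + 0#)   ≈⟨ *-congˡ (f⊥ zero zero) ⟩
      b * (1# * 1#)            ≈⟨ solve 1 (λ b → b :* (:1 :* :1) := b) refl b ⟩
      b                        ∎)
      where z = f zero zero
    orthonormal⇒square {suc n} b f f⊥ with signAway (f zero (suc zero))
    ... | ε , μ , εε≈1 , μ[ε-u]≈1 = orthonormal⇒square b h h⊥
      where
      drop : Vector Carrier (suc (suc n)) → Vector Carrier (suc n)
      drop x = x zero ∷ tail (tail x)
      u = f zero (suc zero)
      y : Fin (suc n) → Carrier
      y j = f (suc j) (suc zero)
      h : Fin (suc n) → Vector Carrier (suc n)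
      h j i = 1# * drop (f (suc j)) i + μ * y j * drop (f zero) i
      dropped : ∀ x x′ {d} → form b x x′ ≈ d → form b (drop x) (drop x′) ≈ d - x (suc zero) * x′ (suc zero)
      dropped x x′ {d} eq = begin
        form b (drop x) (drop x′)
          ≈⟨ solve 3 (λ w z t → w :+ t := w :+ (z :+ t) :- z)
               refl (b * (x zero * x′ zero)) (x (suc zero) * x′ (suc zero))
                     (dot (tail (tail x)) (tail (tail x′))) ⟩
        form b x x′ - x (suc zero) * x′ (suc zero)
          ≈⟨ +-congʳ eq ⟩
        d - x (suc zero) * x′ (suc zero) ∎
      -- Before the coordinate is dropped, f₍ⱼ₊₁₎ + μ yⱼ f₀ has there the entry yⱼ (1 + μ u) = ε μ
      -- yⱼ. Since ε² = 1, dropping it removes μ² yⱼ yₖ from the pairings, exactly what the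
      -- multiples of the unit vector f₀ added.
      1+μu≈με : 1# + μ * u ≈ μ * ε
      1+μu≈με = begin
        1# + μ * u              ≈⟨ +-congʳ μ[ε-u]≈1 ⟨
        μ * (ε - u) + μ * u     ≈⟨ solve 3 (λ μ ε u → μ :* (ε :- u) :+ μ :* u := μ :* ε) refl μ ε u ⟩
        μ * ε                   ∎
      h⊥ : OrthogonalOfNorm b 1# h
      h⊥ j k = begin
        form b (h j) (h k)
          ≈⟨ form-lin b 1# (μ * y j) 1# (μ * y k) (drop (f (suc j))) (drop (f zero)) (drop (f (suc k)))
                (drop (f zero)) ⟩
        _ ≈⟨ +-cong
               (*-congˡ (+-cong (*-congˡ (dropped (f (suc j)) (f (suc k)) (f⊥ (suc j) (suc k))))
                     (*-congˡ (dropped (f (suc j)) (f zero) (f⊥ (suc j) zero)))))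
               (*-congˡ (+-cong (*-congˡ (dropped (f zero) (f (suc k)) (f⊥ zero (suc k))))
                     (*-congˡ (dropped (f zero) (f zero) (f⊥ zero zero))))) ⟩
        _ ≈⟨ solve 5 (λ δ yj yk μ u →
               :1 :* (:1 :* (:1 :* δ :- yj :* yk) :+ μ :* yk :* (:1 :* :0 :- yj :* u)) :+
               μ :* yj :* (:1 :* (:1 :* :0 :- u :* yk) :+ μ :* yk :* (:1 :* :1 :- u :* u)) :=
               :1 :* δ :+ yj :* yk :* (μ :* μ :- (:1 :+ μ :* u) :* (:1 :+ μ :* u)))
               refl (δ j k) (y j) (y k) μ u ⟩
        1# * δ j k + y j * y k * (μ * μ - (1# + μ * u) * (1# + μ * u))
          ≈⟨ +-congˡ (*-congˡ (+-congˡ (-‿cong (*-cong 1+μu≈με 1+μu≈με)))) ⟩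
        1# * δ j k + y j * y k * (μ * μ - (μ * ε) * (μ * ε))
          ≈⟨ solve 5 (λ δ yj yk μ ε → :1 :* δ :+ yj :* yk :* (μ :* μ :- (μ :* ε) :* (μ :* ε)) :=
               :1 :* δ :+ yj :* yk :* (μ :* μ) :* (:1 :- ε :* ε)) refl (δ j k) (y j) (y k) μ ε ⟩
        1# * δ j k + y j * y k * (μ * μ) * (1# - ε * ε)
          ≈⟨ +-congˡ (trans (*-congˡ (x≈y⇒x∙y⁻¹≈ε (sym εε≈1))) (zeroʳ _)) ⟩
        1# * δ j k + 0#
          ≈⟨ +-identityʳ _ ⟩
        1# * δ j k ∎

  -- Squared distances and Gram matrices: lifting points, and projecting an antibasis.

  sqDist : ∀ {n} → Vector Carrier n → Vector Carrier n → Carrier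
  sqDist x y = dot (λ i → x i - y i) (λ i → x i - y i)

  sqDist-expand : ∀ {n} (x y : Vector Carrier n) →
                  sqDist x y ≈ dot x x + dot y y - (1# + 1#) * dot x y
  sqDist-expand {zero}  x y = solve 0 (:0 := :0 :+ :0 :- (:1 :+ :1) :* :0) refl
  sqDist-expand {suc n} x y = trans (+-congˡ (sqDist-expand (tail x) (tail y)))
    (solve 5 (λ x y xx yy xy →
       (x :- y) :* (x :- y) :+ (xx :+ yy :- (:1 :+ :1) :* xy) :=
       (x :* x :+ xx) :+ (y :* y :+ yy) :- (:1 :+ :1) :* (x :* y :+ xy))
       refl (x zero) (y zero) (dot (tail x) (tail x)) (dot (tail y) (tail y)) (dot (tail x) (tail y)))

  sqDist-refl : ∀ {n} (x : Vector Carrier n) → sqDist x x ≈ 0#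
  sqDist-refl x = trans (sqDist-expand x x)
    (solve 1 (λ g → g :+ g :- (:1 :+ :1) :* g := :0) refl (dot x x))

  δ-sym : ∀ {n} (j k : Fin n) → δ j k ≡ δ k j
  δ-sym zero    zero    = ≡.refl
  δ-sym zero    (suc k) = ≡.refl
  δ-sym (suc j) zero    = ≡.refl
  δ-sym (suc j) (suc k) = δ-sym j k

  standardBasis : ∀ {n} → OrthogonalOfNorm {n = n} 1# 1# δ
  standardBasis j k = begin
    1# * (δ j zero * δ k zero) + dot (tail (δ j)) (tail (δ k))
      ≈⟨ +-congʳ (*-identityˡ _) ⟩
    dot (δ j) (δ k)
      ≈⟨ sum-cong-≋ (λ i → *-congˡ {δ j i} (reflexive (δ-sym k i))) ⟩
    dot (δ j) (λ i → δ i k)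
      ≈⟨ dot-δ (δ j) k ⟩
    δ j k
      ≈⟨ *-identityˡ _ ⟨
    1# * δ j k ∎

  OrthogonalOfNorm-cong : ∀ {m n a a′} b (f : Fin m → Vector Carrier (suc n)) → a ≈ a′ →
                          OrthogonalOfNorm b a f → OrthogonalOfNorm b a′ f
  OrthogonalOfNorm-cong b f a≈a′ f⊥ j k = trans (f⊥ j k) (*-congʳ a≈a′)

  -- Rotation needs an index set of the literal form `Fin (m ℕ.* 2)`; matching on the divisibility
  -- witness supplies it.
  renorm : ∀ {m n} b a r s → 2 ∣ m → (f : Fin m → Vector Carrier (suc n)) → OrthogonalOfNorm b a f →
           Σ[ g ∈ (Fin m → Vector Carrier (suc n)) ] OrthogonalOfNorm b ((r * r + s * s) * a) g
  renorm b a r s (divides m ≡.refl) f f⊥ = rotatePairs m r s f , rotatePairs-orthogonal b a m r s f f⊥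

  antibasis-even : ∀ {n} r s → r * r + s * s ≈ - 1# → 2 ∣ suc n →
                   Σ[ g ∈ (Fin (suc n) → Vector Carrier (suc n)) ] OrthogonalOfNorm 1# (- 1#) g
  antibasis-even r s rr+ss≈-1 2∣1+n with renorm 1# 1# r s 2∣1+n δ standardBasis
  ... | g , g⊥ = g , OrthogonalOfNorm-cong 1# g (trans (*-identityʳ _) rr+ss≈-1) g⊥

  antibasis-square : ∀ {n} i → i * i ≈ - 1# →
                     Σ[ g ∈ (Fin (suc n) → Vector Carrier (suc n)) ] OrthogonalOfNorm 1# (- 1#) g
  -- The summand with coefficient 0 only gives the vectors the shape that `form-lin` expects.
  antibasis-square i ii≈-1 = (λ j l → i * δ j l + 0# * δ j l) , λ j k → begin
    _ ≈⟨ form-lin 1# i 0# i 0# (δ j) (δ j) (δ k) (δ k) ⟩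
    _ ≈⟨ solve 2 (λ i f → i :* (i :* f :+ :0 :* f) :+ :0 :* (i :* f :+ :0 :* f) := i :* i :* f)
         refl i (form 1# (δ j) (δ k)) ⟩
    i * i * form 1# (δ j) (δ k) ≈⟨ *-cong ii≈-1 (trans (standardBasis j k) (*-identityˡ _)) ⟩
    - 1# * δ j k ∎

  -- For b = -1, pairing with this isotropic vector adds the first two coordinates, a sum that
  -- `lift` makes equal to 1.
  pole : ∀ {n} → Vector Carrier (suc (suc n))
  pole = - 1# ∷ 1# ∷ λ _ → 0#

  form-pole-pole : ∀ {n} → form (- 1#) (pole {n}) pole ≈ 0#
  form-pole-pole {n} = trans (+-congˡ (+-congˡ (dot-zeroʳ {n} (λ _ → 0#))))
    (solve 0 ((:- :1) :* ((:- :1) :* (:- :1)) :+ (:1 :* :1 :+ :0) := :0) refl)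

  -- A point of Fⁿ at squared distance 2C from another one is lifted to an
  -- orthogonal vector in ⟨-1⟩ ⊥ ⟨1⟩ ⊥ Fⁿ, the hyperbolic plane carrying the
  -- product of the coordinates 1 and C - Q(x).
  module _ (h : Carrier) (h[1+1]≈1 : h * (1# + 1#) ≈ 1#) (C : Carrier) where

    lift : ∀ {n} → Vector Carrier n → Vector Carrier (suc (suc n))
    lift x = h * (1# - (C - dot x x)) ∷ h * (1# + (C - dot x x)) ∷ x

    -- With h = 1/2, the first two coordinates contribute C - (Q(x) + Q(y))/2, and x · y completes
    -- this to C - Q(x - y)/2. So squared distance 2C turns into orthogonality, and a point paired
    -- with itself gives C.
    form-lift : ∀ {n} (x y : Vector Carrier n) → form (- 1#) (lift x) (lift y) ≈ C - h * sqDist x y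
    form-lift x y = begin
      form (- 1#) (lift x) (lift y)
        ≈⟨ solve 4 (λ h A B xy →
             (:- :1) :* (h :* (:1 :- A) :* (h :* (:1 :- B))) :+
             (h :* (:1 :+ A) :* (h :* (:1 :+ B)) :+ xy) :=
             h :* (:1 :+ :1) :* (h :* (A :+ B)) :+ xy)
             refl h (C - dot x x) (C - dot y y) (dot x y) ⟩
      h * (1# + 1#) * (h * (C - dot x x + (C - dot y y))) + dot x y
        ≈⟨ +-congʳ (trans (*-congʳ h[1+1]≈1) (*-identityˡ _)) ⟩
      h * (C - dot x x + (C - dot y y)) + dot x y
        ≈⟨ solve 5 (λ h C xx yy xy →
             h :* (C :- xx :+ (C :- yy)) :+ xy :=
             h :* (:1 :+ :1) :* (C :- xy) :+ xy :- h :* (xx :+ yy :- (:1 :+ :1) :* xy))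
             refl h C (dot x x) (dot y y) (dot x y) ⟩
      h * (1# + 1#) * (C - dot x y) + dot x y - h * (dot x x + dot y y - (1# + 1#) * dot x y)
        ≈⟨ +-congʳ (+-congʳ (*-congʳ h[1+1]≈1)) ⟩
      1# * (C - dot x y) + dot x y - h * (dot x x + dot y y - (1# + 1#) * dot x y)
        ≈⟨ +-congʳ (solve 2 (λ C xy → :1 :* (C :- xy) :+ xy := C) refl C (dot x y)) ⟩
      C - h * (dot x x + dot y y - (1# + 1#) * dot x y)
        ≈⟨ +-congˡ (-‿cong (*-congˡ (sqDist-expand x y))) ⟨
      C - h * sqDist x y ∎

    lift-orthogonal : ∀ {m n} (P : Fin m → Vector Carrier n) →
                      (∀ j k → j ≢ k → sqDist (P j) (P k) ≈ (1# + 1#) * C) →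
                      OrthogonalOfNorm (- 1#) C (λ j → lift (P j))
    lift-orthogonal P equilateral j k with j Finₚ.≟ k
    ... | yes ≡.refl = begin
      form (- 1#) (lift (P j)) (lift (P j)) ≈⟨ form-lift (P j) (P j) ⟩
      C - h * sqDist (P j) (P j)            ≈⟨ +-congˡ (-‿cong (*-congˡ (sqDist-refl (P j)))) ⟩
      C - h * 0#                            ≈⟨ solve 2 (λ h C → C :- h :* :0 := C :* :1) refl h C ⟩
      C * 1#                                ≡⟨ ≡.cong (C *_) (δ-diag j) ⟨
      C * δ j j                             ∎
    ... | no j≢k = begin
      form (- 1#) (lift (P j)) (lift (P k)) ≈⟨ form-lift (P j) (P k) ⟩
      C - h * sqDist (P j) (P k)            ≈⟨ +-congˡ (-‿cong (*-congˡ (equilateral j k j≢k))) ⟩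
      C - h * ((1# + 1#) * C)
        ≈⟨ solve 2 (λ h C → C :- h :* ((:1 :+ :1) :* C) := C :* (:1 :- h :* (:1 :+ :1))) refl h C ⟩
      C * (1# - h * (1# + 1#))              ≈⟨ *-congˡ (x≈y⇒x∙y⁻¹≈ε (sym h[1+1]≈1)) ⟩
      C * 0#                                ≡⟨ ≡.cong (C *_) (δ-off j≢k) ⟨
      C * δ j k                             ∎

    form-lift-pole : ∀ {n} (x : Vector Carrier n) → form (- 1#) (lift x) pole ≈ 1#
    form-lift-pole x = trans (+-congˡ (+-congˡ (dot-zeroʳ x))) (trans
      (solve 2 (λ h A → (:- :1) :* (h :* (:1 :- A) :* (:- :1)) :+ (h :* (:1 :+ A) :* :1 :+ :0) :=
        h :* (:1 :+ :1)) refl h (C - dot x x))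
      h[1+1]≈1)

  -- A relation a₀ n + ∑ aₖ fₖ = 0, paired with fⱼ, gives a₀ + C aⱼ = 0;
  -- paired with n it gives ∑ aₖ = 0.
  orthogonal-pole⇒size≈0 : ∀ {m} b C → C ≉ 0# → (f : Fin (suc m) → Vector Carrier (suc m)) →
    OrthogonalOfNorm b C f → (n : Vector Carrier (suc m)) → form b n n ≈ 0# →
    (∀ k → form b (f k) n ≈ 1#) → sum {suc m} (λ _ → 1#) ≈ 0#
  orthogonal-pole⇒size≈0 {m} b C C≉0 f f⊥ n nn≈0 fn≈1
    -- The family `n ∷ f` has one vector more than the dimension.
    with 1+n-vectors-dependent (suc m) (n ∷ f)
  ... | a , (k , aₖ≉0) , relation = size≈0
    where
    a₀ = a zero
    pair : ∀ y → a₀ * form b n y + sum (λ k → a (suc k) * form b (f k) y) ≈ 0#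
    pair y = begin
      a₀ * form b n y + sum (λ k → a (suc k) * form b (f k) y)
        ≈⟨ form-sumˡ b a (n ∷ f) y ⟨
      form b combination y
        ≈⟨ form-congˡ b {combination} {λ _ → 0#} y relation ⟩
      form b (λ _ → 0#) y
        ≈⟨ form-zeroˡ b y ⟩
      0# ∎
      where
      combination : Vector Carrier (suc m)
      combination i = sum (λ k → a k * (n ∷ f) k i)
    ∑a≈0 : sum (tail a) ≈ 0#
    ∑a≈0 = begin
      sum (tail a)
        ≈⟨ sum-cong-≋ (λ k → trans (sym (*-identityʳ (a (suc k)))) (*-congˡ (sym (fn≈1 k)))) ⟩
      sum (λ k → a (suc k) * form b (f k) n)
        ≈⟨ trans (+-congʳ (trans (*-congˡ nn≈0) (zeroʳ a₀))) (+-identityˡ _) ⟨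
      a₀ * form b n n + sum (λ k → a (suc k) * form b (f k) n)
        ≈⟨ pair n ⟩
      0# ∎
    a₀+Ca≈0 : ∀ j → a₀ + C * a (suc j) ≈ 0#
    a₀+Ca≈0 j = begin
      a₀ + C * a (suc j)
        ≈⟨ +-cong (trans (sym (*-identityʳ a₀)) (*-congˡ (sym (trans (form-comm b n (f j)) (fn≈1 j)))))
              (*-congˡ (sym (dot-δ (tail a) j))) ⟩
      a₀ * form b n (f j) + C * dot (tail a) (λ k → δ k j)
        ≈⟨ +-congˡ (*-distribˡ-sum C (λ k → a (suc k) * δ k j)) ⟩
      a₀ * form b n (f j) + sum (λ k → C * (a (suc k) * δ k j))
        ≈⟨ +-congˡ (sum-cong-≋ (λ k → trans
             (solve 3 (λ C a d → C :* (a :* d) := a :* (C :* d)) refl C (a (suc k)) (δ k j))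
             (*-congˡ (sym (f⊥ k j))))) ⟩
      a₀ * form b n (f j) + sum (λ k → a (suc k) * form b (f k) (f j))
        ≈⟨ pair (f j) ⟩
      0# ∎
    -- If a₀ were zero, C ≠ 0 would make every other coefficient vanish as well.
    a₀≉0 : a₀ ≉ 0#
    a₀≉0 a₀≈0 = aₖ≉0 (a≈0 k)
      where
      a≈0 : ∀ k → a k ≈ 0#
      a≈0 zero = a₀≈0
      a≈0 (suc j) = x≉0∧xy≈0⇒y≈0 C≉0 (begin
        C * a (suc j)        ≈⟨ +-identityˡ _ ⟨
        0# + C * a (suc j)   ≈⟨ +-congʳ a₀≈0 ⟨
        a₀ + C * a (suc j)   ≈⟨ a₀+Ca≈0 j ⟩
        0#                   ∎)
    -- The sum of `a₀+Ca≈0` over all j, in which the terms C aⱼ cancel by `∑a≈0`.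
    a₀*size≈0 : a₀ * sum {suc m} (λ _ → 1#) ≈ 0#
    a₀*size≈0 = begin
      a₀ * sum {suc m} (λ _ → 1#)
        ≈⟨ *-distribˡ-sum {suc m} a₀ (λ _ → 1#) ⟩
      sum {suc m} (λ _ → a₀ * 1#)
        ≈⟨ +-identityʳ _ ⟨
      sum {suc m} (λ _ → a₀ * 1#) + 0#
        ≈⟨ +-cong (sum-cong-≋ {suc m} (λ _ → *-identityʳ a₀)) (sym (trans (*-congˡ ∑a≈0) (zeroʳ C))) ⟩
      sum {suc m} (λ _ → a₀) + C * sum (tail a)
        ≈⟨ +-congˡ (*-distribˡ-sum C (tail a)) ⟩
      sum {suc m} (λ _ → a₀) + sum (λ j → C * a (suc j))
        ≈⟨ ∑-distrib-+ (λ _ → a₀) (λ j → C * a (suc j)) ⟨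
      sum (λ j → a₀ + C * a (suc j))
        ≈⟨ sum-cong-≋ a₀+Ca≈0 ⟩
      sum {suc m} (λ _ → 0#)
        ≈⟨ sum-replicate-zero (suc m) ⟩
      0# ∎
    size≈0 : sum {suc m} (λ _ → 1#) ≈ 0#
    size≈0 = x≉0∧xy≈0⇒y≈0 a₀≉0 a₀*size≈0

  dot-tail : ∀ {n} (x y : Vector Carrier (suc n)) {e} → form 1# x y ≈ e →
             dot (tail x) (tail y) ≈ e - x zero * y zero
  dot-tail x y {e} eq = begin
    dot (tail x) (tail y)
      ≈⟨ solve 2 (λ z t → t := :1 :* z :+ t :- z) refl (x zero * y zero) (dot (tail x) (tail y)) ⟩
    form 1# x y - x zero * y zero
      ≈⟨ +-congʳ eq ⟩
    e - x zero * y zero ∎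

  -- The τ terms cancel from G(j,j) + G(k,k) - 2 G(j,k). They record multiples of an isotropic
  -- vector, added to points that all have the same pairing with it.
  shifted-gram⇒equilateral : ∀ {m n} (P : Fin m → Vector Carrier n) (τ : Vector Carrier m) →
    (∀ j k → dot (P j) (P k) ≈ τ j + τ k - δ j k) →
    ∀ j k → j ≢ k → sqDist (P j) (P k) ≈ - (1# + 1#)
  shifted-gram⇒equilateral P τ gram j k j≢k = begin
    sqDist (P j) (P k)
      ≈⟨ sqDist-expand (P j) (P k) ⟩
    dot (P j) (P j) + dot (P k) (P k) - (1# + 1#) * dot (P j) (P k)
      ≈⟨ +-cong (+-cong (gram′ (δ-diag j)) (gram′ (δ-diag k))) (-‿cong (*-congˡ (gram′ (δ-off j≢k)))) ⟩
    τ j + τ j - 1# + (τ k + τ k - 1#) - (1# + 1#) * (τ j + τ k - 0#)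
      ≈⟨ solve 2 (λ s t → s :+ s :- :1 :+ (t :+ t :- :1) :- (:1 :+ :1) :* (s :+ t :- :0) := :- (:1 :+ :1))
           refl (τ j) (τ k) ⟩
    - (1# + 1#) ∎
    where
    gram′ : ∀ {j k e} → δ j k ≡ e → dot (P j) (P k) ≈ τ j + τ k - e
    gram′ {j} {k} ≡.refl = gram j k

  antibasis⇒equilateral : ∀ {d} → 1# + 1# ≉ 0# → (g : Fin (suc d) → Vector Carrier (suc d)) →
    OrthogonalOfNorm 1# (- 1#) g → sum {suc (suc d)} (λ _ → 1#) ≈ 0# →
    Σ[ P ∈ (Fin (suc (suc d)) → Vector Carrier d) ] ∀ j k → j ≢ k → sqDist (P j) (P k) ≈ - (1# + 1#)
  antibasis⇒equilateral {d} 1+1≉0 g g⊥ size≈0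
    with signAway 1+1≉0 (sum (λ k → 1# * g k zero))
  ... | ε , μ , εε≈1 , μ[ε-β]≈1 = P , shifted-gram⇒equilateral P τ gram
    where
    u : Vector Carrier (suc d)
    u i = sum (λ k → 1# * g k i)
    β = u zero
    y : Vector Carrier (suc d)
    y k = g k zero
    P : Fin (suc (suc d)) → Vector Carrier d
    -- For the last basis vector e, the vector e + t(u + e) has first coordinate t β and last
    -- coordinate 1 + t. Requiring t β = ε (1 + t) gives t = -μ ε. The zero summand only fits
    -- `dot-lin`.
    P zero    i = - (μ * ε) * u (suc i) + 0# * u (suc i)
    -- Likewise gₖ + t(u + e) has first coordinate yₖ + t β and last coordinate t; the former is ε t
    -- exactly for t = μ yₖ.
    P (suc k) i = 1# * g k (suc i) + μ * y k * u (suc i)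
    -- These are the values -t, because u + e pairs to -1 with e and with every gₖ.
    τ : Vector Carrier (suc (suc d))
    τ zero    = μ * ε
    τ (suc k) = - (μ * y k)

    ug : ∀ k → form 1# u (g k) ≈ - 1#
    ug k = begin
      form 1# u (g k)                            ≈⟨ form-sumˡ 1# (λ _ → 1#) g (g k) ⟩
      sum (λ j → 1# * form 1# (g j) (g k))       ≈⟨ sum-cong-≋ (λ j → trans (*-identityˡ _) (g⊥ j k)) ⟩
      dot (λ _ → - 1#) (λ j → δ j k)             ≈⟨ dot-δ (λ _ → - 1#) k ⟩
      - 1#                                       ∎
    uu : form 1# u u ≈ 1#
    uu = begin
      form 1# u u                                ≈⟨ form-sumˡ 1# (λ _ → 1#) g u ⟩
      sum (λ j → 1# * form 1# (g j) u)
        ≈⟨ sum-cong-≋ (λ j → trans (*-identityˡ _)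
              (trans (form-comm 1# (g j) u) (trans (ug j) (sym (*-identityʳ _))))) ⟩
      sum {suc d} (λ _ → - 1# * 1#)              ≈⟨ *-distribˡ-sum {suc d} (- 1#) (λ _ → 1#) ⟨
      -- Here S stands for d + 1, and `size≈0` unfolds to 1 + S ≈ 0.
      - 1# * S                                   ≈⟨ solve 1 (λ S → (:- :1) :* S := :1 :- (:1 :+ S)) refl S ⟩
      1# - (1# + S)                              ≈⟨ +-congˡ (-‿cong size≈0) ⟩
      1# - 0#                                    ≈⟨ solve 0 (:1 :- :0 := :1) refl ⟩
      1#                                         ∎
      where S = sum {suc d} (λ _ → 1#)

    gg′ : ∀ j k → dot (tail (g j)) (tail (g k)) ≈ - 1# * δ j k - y j * y k
    gg′ j k = dot-tail (g j) (g k) (g⊥ j k)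
    ug′ : ∀ k → dot (tail u) (tail (g k)) ≈ - 1# - β * y k
    ug′ k = dot-tail u (g k) (ug k)
    gu′ : ∀ k → dot (tail (g k)) (tail u) ≈ - 1# - β * y k
    gu′ k = trans (dot-comm (tail (g k)) (tail u)) (ug′ k)
    uu′ : dot (tail u) (tail u) ≈ 1# - β * β
    uu′ = dot-tail u u uu

    -- Eliminates β from the Gram entries; what is left reduces by ε² = 1.
    μβ≈με-1 : μ * β ≈ μ * ε - 1#
    μβ≈με-1 = begin
      μ * β                   ≈⟨ solve 3 (λ μ β ε → μ :* β := μ :* ε :- μ :* (ε :- β)) refl μ β ε ⟩
      μ * ε - μ * (ε - β)     ≈⟨ +-congˡ (-‿cong μ[ε-β]≈1) ⟩
      μ * ε - 1#              ∎

    gram : ∀ j k → dot (P j) (P k) ≈ τ j + τ k - δ j k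
    gram zero zero = begin
      dot (P zero) (P zero)
        ≈⟨ dot-lin (- (μ * ε)) 0# (- (μ * ε)) 0# (tail u) (tail u) (tail u) (tail u) ⟩
      _ ≈⟨ solve 2 (λ a D → (:- a) :* ((:- a) :* D :+ :0 :* D) :+ :0 :* ((:- a) :* D :+ :0 :* D) := a :* a :* D)
           refl (μ * ε) (dot (tail u) (tail u)) ⟩
      μ * ε * (μ * ε) * dot (tail u) (tail u)
        ≈⟨ *-congˡ uu′ ⟩
      μ * ε * (μ * ε) * (1# - β * β)
        ≈⟨ solve 3 (λ μ ε β → μ :* ε :* (μ :* ε) :* (:1 :- β :* β) :=
              μ :* ε :* (μ :* ε) :- ε :* ε :* (μ :* β :* (μ :* β)))
             refl μ ε β ⟩
      μ * ε * (μ * ε) - ε * ε * (μ * β * (μ * β))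
        ≈⟨ +-congˡ (-‿cong (*-cong εε≈1 (*-cong μβ≈με-1 μβ≈με-1))) ⟩
      μ * ε * (μ * ε) - 1# * ((μ * ε - 1#) * (μ * ε - 1#))
        ≈⟨ solve 1 (λ a → a :* a :- :1 :* ((a :- :1) :* (a :- :1)) := a :+ a :- :1) refl (μ * ε) ⟩
      μ * ε + μ * ε - 1# ∎
    gram zero (suc k) = begin
      dot (P zero) (P (suc k))
        ≈⟨ dot-lin (- (μ * ε)) 0# 1# (μ * y k) (tail u) (tail u) (tail (g k)) (tail u) ⟩
      _ ≈⟨ solve 4 (λ a z G D → (:- a) :* (:1 :* G :+ z :* D) :+ :0 :* (:1 :* G :+ z :* D) :=
            (:- a) :* (G :+ z :* D))
           refl (μ * ε) (μ * y k) (dot (tail u) (tail (g k))) (dot (tail u) (tail u)) ⟩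
      - (μ * ε) * (dot (tail u) (tail (g k)) + μ * y k * dot (tail u) (tail u))
        ≈⟨ *-congˡ (+-cong (ug′ k) (*-congˡ uu′)) ⟩
      - (μ * ε) * (- 1# - β * y k + μ * y k * (1# - β * β))
        ≈⟨ solve 4 (λ μ ε β y → (:- (μ :* ε)) :* ((:- :1) :- β :* y :+ μ :* y :* (:1 :- β :* β)) :=
             μ :* ε :+ ε :* (y :* (μ :* β :+ μ :* β :* (μ :* β) :- μ :* μ))) refl μ ε β (y k) ⟩
      μ * ε + ε * (y k * (μ * β + μ * β * (μ * β) - μ * μ))
        ≈⟨ +-congˡ (*-congˡ (*-congˡ (+-congʳ (+-cong μβ≈με-1 (*-cong μβ≈με-1 μβ≈με-1))))) ⟩
      μ * ε + ε * (y k * (μ * ε - 1# + (μ * ε - 1#) * (μ * ε - 1#) - μ * μ))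
        ≈⟨ solve 3 (λ μ ε y →
              μ :* ε :+ ε :* (y :* (μ :* ε :- :1 :+ (μ :* ε :- :1) :* (μ :* ε :- :1) :- μ :* μ)) :=
             μ :* ε :- μ :* y :* (ε :* ε) :+ ε :* y :* (μ :* μ) :* (ε :* ε :- :1)) refl μ ε (y k) ⟩
      μ * ε - μ * y k * (ε * ε) + ε * y k * (μ * μ) * (ε * ε - 1#)
        ≈⟨ +-cong (+-congˡ (-‿cong (*-congˡ εε≈1))) (*-congˡ (x≈y⇒x∙y⁻¹≈ε εε≈1)) ⟩
      μ * ε - μ * y k * 1# + ε * y k * (μ * μ) * 0#
        ≈⟨ solve 3 (λ a b c → a :- b :* :1 :+ c :* :0 := a :+ :- b :- :0)
             refl (μ * ε) (μ * y k) (ε * y k * (μ * μ)) ⟩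
      μ * ε + - (μ * y k) - 0# ∎
    gram (suc j) zero = begin
      dot (P (suc j)) (P zero)          ≈⟨ dot-comm (P (suc j)) (P zero) ⟩
      dot (P zero) (P (suc j))          ≈⟨ gram zero (suc j) ⟩
      μ * ε + - (μ * y j) - 0#          ≈⟨ +-congʳ (+-comm _ _) ⟩
      - (μ * y j) + μ * ε - 0#          ∎
    gram (suc j) (suc k) = begin
      dot (P (suc j)) (P (suc k))
        ≈⟨ dot-lin 1# (μ * y j) 1# (μ * y k) (tail (g j)) (tail u) (tail (g k)) (tail u) ⟩
      _ ≈⟨ +-cong (*-congˡ (+-cong (*-congˡ (gg′ j k)) (*-congˡ (gu′ j))))
            (*-congˡ (+-cong (*-congˡ (ug′ k)) (*-congˡ uu′))) ⟩
      _ ≈⟨ solve 5 (λ μ β y z δ →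
             :1 :* (:1 :* ((:- :1) :* δ :- y :* z) :+ μ :* z :* (:- :1 :- β :* y)) :+
             μ :* y :* (:1 :* (:- :1 :- β :* z) :+ μ :* z :* (:1 :- β :* β)) :=
             :- (μ :* y) :+ :- (μ :* z) :- δ :+ y :* z :* (μ :* μ :- (:1 :+ μ :* β) :* (:1 :+ μ :* β)))
             refl μ β (y j) (y k) (δ j k) ⟩
      - (μ * y j) + - (μ * y k) - δ j k + y j * y k * (μ * μ - (1# + μ * β) * (1# + μ * β))
        ≈⟨ +-congˡ (*-congˡ (+-congˡ (-‿cong (*-cong (+-congˡ μβ≈με-1) (+-congˡ μβ≈με-1))))) ⟩
      - (μ * y j) + - (μ * y k) - δ j k + y j * y k * (μ * μ - (1# + (μ * ε - 1#)) * (1# + (μ * ε - 1#)))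
        ≈⟨ +-congˡ (solve 4 (λ μ ε y z →
              y :* z :* (μ :* μ :- (:1 :+ (μ :* ε :- :1)) :* (:1 :+ (μ :* ε :- :1))) :=
              y :* z :* (μ :* μ) :* (:1 :- ε :* ε))
             refl μ ε (y j) (y k)) ⟩
      - (μ * y j) + - (μ * y k) - δ j k + y j * y k * (μ * μ) * (1# - ε * ε)
        ≈⟨ +-congˡ (trans (*-congˡ (x≈y⇒x∙y⁻¹≈ε (sym εε≈1))) (zeroʳ _)) ⟩
      - (μ * y j) + - (μ * y k) - δ j k + 0#
        ≈⟨ +-identityʳ _ ⟩
      - (μ * y j) + - (μ * y k) - δ j k ∎

-- Counting in finite sets, and the parity forced by an involution.

module Counting where
  open ℕSum ℕₚ.+-0-commutativeMonoid
  open ≡.≡-Reasoning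

  private variable
    p r : Level
    A B : Set p
    n : ℕ

  indicator : Dec A → ℕ
  indicator a? = if does a? then 1 else 0

  indicator-true : (a? : Dec A) → A → indicator a? ≡ 1
  indicator-true (yes _) a = ≡.refl
  indicator-true (no ¬a) a = contradiction a ¬a

  indicator-false : (a? : Dec A) → ¬ A → indicator a? ≡ 0
  indicator-false (yes a) ¬a = contradiction a ¬a
  indicator-false (no _)  ¬a = ≡.refl

  indicator-cong : (a? : Dec A) (b? : Dec B) → (A → B) → (B → A) → indicator a? ≡ indicator b?
  indicator-cong (yes a) b? f g = ≡.sym (indicator-true b? (f a))
  indicator-cong (no ¬a) b? f g = ≡.sym (indicator-false b? (λ b → ¬a (g b)))

  count : {P : Pred (Fin n) p} → Decidable P → ℕ
  count P? = sum (λ i → indicator (P? i))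

  count-all : {P : Pred (Fin n) p} (P? : Decidable P) → (∀ i → P i) → count P? ≡ n
  count-all {zero}  P? all = ≡.refl
  count-all {suc n} P? all =
    ≡.cong₂ ℕ._+_ (indicator-true (P? zero) (all zero)) (count-all (λ i → P? (suc i)) (λ i → all (suc i)))

  count-none : {P : Pred (Fin n) p} (P? : Decidable P) → (∀ i → ¬ P i) → count P? ≡ 0
  count-none {n} P? none = ≡.trans (sum-cong-≗ (λ i → indicator-false (P? i) (none i))) (sum-replicate-zero n)

  count-unique : {P : Pred (Fin n) p} (P? : Decidable P) (k : Fin n) → P k → (∀ i → P i → i ≡ k) → count P? ≡ 1
  count-unique {suc n} P? k Pk unique = begin
    count P?
      ≡⟨ sum-remove {i = k} (λ i → indicator (P? i)) ⟩
    indicator (P? k) ℕ.+ count (λ i → P? (punchIn k i))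
      ≡⟨ ≡.cong₂ ℕ._+_ (indicator-true (P? k) Pk)
           (count-none (λ i → P? (punchIn k i)) (λ i Pi → Finₚ.punchInᵢ≢i k i (unique _ Pi))) ⟩
    1 ∎

  count-cong : {P : Pred (Fin n) p} {Q : Pred (Fin n) r} (P? : Decidable P) (Q? : Decidable Q) →
               (∀ i → P i → Q i) → (∀ i → Q i → P i) → count P? ≡ count Q?
  count-cong P? Q? f g = sum-cong-≗ (λ i → indicator-cong (P? i) (Q? i) (f i) (g i))

  -- σ exchanges the elements i with i < σ i and those with σ i < i.
  count-involution : {P : Pred (Fin n) p} (P? : Decidable P) (σ : Fin n → Fin n) →
    (∀ i → σ (σ i) ≡ i) → (∀ i → P i → P (σ i)) →
    count P? ≡ count (λ i → P? i ×-dec i Finₚ.<? σ i) ℕ.* 2 ℕ.+ count (λ i → P? i ×-dec σ i Finₚ.≟ i)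
  count-involution {P = P} P? σ σσ Pσ = begin
    count P?
      ≡⟨ sum-cong-≗ split ⟩
    sum (λ i → below i ℕ.+ above i ℕ.+ fixed i)
      ≡⟨ ∑-distrib-+ (λ i → below i ℕ.+ above i) fixed ⟩
    sum (λ i → below i ℕ.+ above i) ℕ.+ sum fixed
      ≡⟨ ≡.cong (ℕ._+ sum fixed) (∑-distrib-+ below above) ⟩
    sum below ℕ.+ sum above ℕ.+ sum fixed
      ≡⟨ ≡.cong (λ k → sum below ℕ.+ k ℕ.+ sum fixed)
            (≡.trans (sum-cong-≗ above≗below∘σ) (≡.sym (sum-permute below π))) ⟩
    sum below ℕ.+ sum below ℕ.+ sum fixed
      ≡⟨ ≡.cong (ℕ._+ sum fixed) (double (sum below)) ⟩
    sum below ℕ.* 2 ℕ.+ sum fixed ∎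
    where
    below above fixed : Fin _ → ℕ
    below i = indicator (P? i ×-dec i Finₚ.<? σ i)
    above i = indicator (P? i ×-dec σ i Finₚ.<? i)
    fixed i = indicator (P? i ×-dec σ i Finₚ.≟ i)
    π : Perm.Permutation _ _
    π = Perm.permutation σ σ σσ σσ
    double : ∀ k → k ℕ.+ k ≡ k ℕ.* 2
    double k = ≡.trans (≡.cong (k ℕ.+_) (≡.sym (ℕₚ.+-identityʳ k))) (ℕₚ.*-comm 2 k)
    above≗below∘σ : ∀ i → above i ≡ below (σ i)
    above≗below∘σ i = indicator-cong (P? i ×-dec σ i Finₚ.<? i) (P? (σ i) ×-dec σ i Finₚ.<? σ (σ i))
      (λ (Pi , σi<i) → Pσ i Pi , ≡.subst (σ i Fin.<_) (≡.sym (σσ i)) σi<i)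
      (λ (Pσi , σi<σσi) → ≡.subst P (σσ i) (Pσ (σ i) Pσi) , ≡.subst (σ i Fin.<_) (σσ i) σi<σσi)
    split : ∀ i → indicator (P? i) ≡ below i ℕ.+ above i ℕ.+ fixed i
    split i with P? i
    ... | no _  = ≡.refl
    ... | yes _ with Finₚ.<-cmp i (σ i)
    ...   | tri< i<σi i≢σi σi≮i = ≡.sym
          (≡.cong₂ ℕ._+_ (≡.cong₂ ℕ._+_ (indicator-true (i Finₚ.<? σ i) i<σi)
                (indicator-false (σ i Finₚ.<? i) σi≮i))
                      (indicator-false (σ i Finₚ.≟ i) (λ eq → i≢σi (≡.sym eq))))
    ...   | tri≈ i≮σi i≡σi σi≮i = ≡.sym
          (≡.cong₂ ℕ._+_ (≡.cong₂ ℕ._+_ (indicator-false (i Finₚ.<? σ i) i≮σi)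
                (indicator-false (σ i Finₚ.<? i) σi≮i)) (indicator-true (σ i Finₚ.≟ i) (≡.sym i≡σi)))
    ...   | tri> i≮σi i≢σi σi<i = ≡.sym
          (≡.cong₂ ℕ._+_ (≡.cong₂ ℕ._+_ (indicator-false (i Finₚ.<? σ i) i≮σi)
                (indicator-true (σ i Finₚ.<? i) σi<i))
                      (indicator-false (σ i Finₚ.≟ i) (λ eq → i≢σi (≡.sym eq))))

open Counting
open +-*-Solver using () renaming (solve to ℕsolve; con to ℕcon; _:*_ to _ℕ:*_; _:+_ to _ℕ:+_; _:=_ to _ℕ:=_)
private module ≡R = ≡.≡-Reasoning

-- Finite rings through an enumeration of their elements.

module FiniteRing {c ℓ} (R : CommutativeRing c ℓ) (q : ℕ)
  (enumeration : Inverse (CommutativeRing.setoid R) (≡.setoid (Fin q))) where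

  open CommutativeRing R hiding (zero)
  open Inverse enumeration public using (to; from; to-cong; from-cong; strictlyInverseˡ; strictlyInverseʳ)

  to-injective : ∀ {x y} → to x ≡ to y → x ≈ y
  to-injective {x} {y} eq =
    trans (sym (strictlyInverseʳ x)) (trans (from-cong eq) (strictlyInverseʳ y))

  from-injective : ∀ {i j} → from i ≈ from j → i ≡ j
  from-injective {i} {j} eq =
    ≡.trans (≡.sym (strictlyInverseˡ i)) (≡.trans (to-cong eq) (strictlyInverseˡ j))

  infix 4 _≟_
  _≟_ : ∀ x y → Dec (x ≈ y)
  x ≟ y = map′ to-injective to-cong (to x Finₚ.≟ to y)

  search : ∀ {p} {P : Carrier → Set p} → (∀ {x y} → x ≈ y → P x → P y) →
           Decidable P → Dec (∃ P)
  search resp P? = map′ (λ (i , Pi) → from i , Pi)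
    (λ (x , Px) → to x , resp (sym (strictlyInverseʳ x)) Px) (Finₚ.any? (λ i → P? (from i)))

  -- Carries a self-map over to `Fin q`, where `count-involution` applies.
  onIndex : (Carrier → Carrier) → Fin q → Fin q
  onIndex φ i = to (φ (from i))

  onIndex-involutive : ∀ φ → (∀ {x y} → x ≈ y → φ x ≈ φ y) → (∀ x → φ (φ x) ≈ x) →
                       ∀ i → onIndex φ (onIndex φ i) ≡ i
  onIndex-involutive φ φ-cong φφ i = from-injective (trans (strictlyInverseʳ _)
    (trans (φ-cong (strictlyInverseʳ _)) (φφ (from i))))

  onIndex-fixed : ∀ φ {i} → onIndex φ i ≡ i → φ (from i) ≈ from i
  onIndex-fixed φ eq = trans (sym (strictlyInverseʳ _)) (from-cong eq)

  fixed-onIndex : ∀ φ {i} → φ (from i) ≈ from i → onIndex φ i ≡ i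
  fixed-onIndex φ eq = from-injective (trans (strictlyInverseʳ _) eq)

-- Finite fields of odd order: when -1 is a square, and sums of two squares.

module FiniteField {c ℓ} (R : CommutativeRing c ℓ)
  (isDiscreteField : IsDiscreteField R)
  (q : ℕ) (enumeration : Inverse (CommutativeRing.setoid R) (≡.setoid (Fin q))) where

  open CommutativeRing R hiding (zero)
  open FiniteRing R q enumeration
  open DiscreteField R isDiscreteField
  open import Relation.Binary.Reasoning.Setoid setoid

  -- If 2 = 0, then x ↦ x + 1 is an involution without fixed points, and q is even.
  odd⇒1+1≉0 : ¬ 2 ∣ q → 1# + 1# ≉ 0#
  odd⇒1+1≉0 q-odd 1+1≈0 = q-odd (divides A (≡R.begin
    q                                         ≡R.≡⟨ count-all U? (λ _ → tt) ⟨
    count (U? {A = Fin q})                    ≡R.≡⟨ count-involution U? succ succ-involutive (λ _ _ → tt) ⟩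
    A ℕ.* 2 ℕ.+ _
      ≡R.≡⟨ ≡.cong (A ℕ.* 2 ℕ.+_) (count-none (λ i → U? i ×-dec succ i Finₚ.≟ i)
            (λ i (_ , eq) → 1≉0 (no-fixed i eq))) ⟩
    A ℕ.* 2 ℕ.+ 0                             ≡R.≡⟨ ℕₚ.+-identityʳ _ ⟩
    A ℕ.* 2                                   ≡R.∎))
    where
    succ : Fin q → Fin q
    succ = onIndex (_+ 1#)
    A = count (λ i → U? i ×-dec i Finₚ.<? succ i)
    succ-involutive : ∀ i → succ (succ i) ≡ i
    succ-involutive = onIndex-involutive (_+ 1#) +-congʳ
      (λ x → trans (+-assoc x 1# 1#) (trans (+-congˡ 1+1≈0) (+-identityʳ x)))
    no-fixed : ∀ i → succ i ≡ i → 1# ≈ 0#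
    no-fixed i eq = begin
      1#                       ≈⟨ solve 1 (λ x → :1 := x :+ :1 :- x) refl (from i) ⟩
      from i + 1# - from i     ≈⟨ x≈y⇒x∙y⁻¹≈ε (onIndex-fixed (_+ 1#) eq) ⟩
      0#                       ∎

  module OddCharacteristic (1+1≉0 : 1# + 1# ≉ 0#) where

    x≈-x⇒x≈0 : ∀ {x} → x ≈ - x → x ≈ 0#
    x≈-x⇒x≈0 {x} x≈-x = x≉0∧xy≈0⇒y≈0 1+1≉0 (begin
      (1# + 1#) * x  ≈⟨ solve 1 (λ x → (:1 :+ :1) :* x := x :- :- x) refl x ⟩
      x - - x        ≈⟨ x≈y⇒x∙y⁻¹≈ε x≈-x ⟩
      0#             ∎)

    -- A choice of one element from each pair {x, -x} with x ≠ 0.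
    Positive : Carrier → Set
    Positive x = to x Fin.< to (- x)

    positive? : Decidable Positive
    positive? x = to x Finₚ.<? to (- x)

    Positive-resp : ∀ {x y} → x ≈ y → Positive x → Positive y
    Positive-resp x≈y = ≡.subst₂ Fin._<_ (to-cong x≈y) (to-cong (-‿cong x≈y))

    ¬positive⇒positive-neg : ∀ {x} → x ≉ 0# → ¬ Positive x → Positive (- x)
    ¬positive⇒positive-neg {x} x≉0 x≯0 with Finₚ.<-cmp (to x) (to (- x))
    ... | tri< x>0 _ _ = contradiction x>0 x≯0
    ... | tri≈ _ eq _  = contradiction (x≈-x⇒x≈0 (to-injective eq)) x≉0
    ... | tri> _ _ -x>0 = ≡.subst (to (- x) Fin.<_) (to-cong (sym (-‿involutive x))) -x>0

    positive⇒¬positive-neg : ∀ {x} → Positive x → ¬ Positive (- x)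
    positive⇒¬positive-neg {x} x>0 -x>0 =
      Finₚ.<-asym x>0 (≡.subst (to (- x) Fin.<_) (to-cong (-‿involutive x)) -x>0)

    positive⇒≉0 : ∀ {x} → Positive x → x ≉ 0#
    positive⇒≉0 x>0 x≈0 = Finₚ.<-irrefl
      (to-cong (trans x≈0 (trans (sym -0#≈0#) (-‿cong (sym x≈0))))) x>0

    abs : Carrier → Carrier
    abs x with positive? x
    ... | yes _ = x
    ... | no _  = - x

    abs-positive : ∀ {x} → x ≉ 0# → Positive (abs x)
    abs-positive {x} x≉0 with positive? x
    ... | yes x>0 = x>0
    ... | no x≯0  = ¬positive⇒positive-neg x≉0 x≯0

    abs≈± : ∀ x → abs x ≈ x ⊎ abs x ≈ - x
    abs≈± x with positive? x
    ... | yes _ = inj₁ refl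
    ... | no _  = inj₂ refl

    -- A pair {z, -z} has only one positive member.
    ±⇒abs≈ : ∀ {x z} → Positive z → x ≈ z ⊎ x ≈ - z → abs x ≈ z
    ±⇒abs≈ {x} {z} z>0 x≈±z with positive? x
    ±⇒abs≈ z>0 (inj₁ x≈z)  | yes _   = x≈z
    ±⇒abs≈ z>0 (inj₂ x≈-z) | yes x>0 = contradiction (Positive-resp x≈-z x>0) (positive⇒¬positive-neg z>0)
    ±⇒abs≈ z>0 (inj₁ x≈z)  | no x≯0  = contradiction (Positive-resp (sym x≈z) z>0) x≯0
    ±⇒abs≈ z>0 (inj₂ x≈-z) | no _    = trans (-‿cong x≈-z) (-‿involutive _)

    positiveCount : ℕ
    positiveCount = count (λ i → positive? (from i))

    -- Negation is an involution whose only fixed point is 0.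
    q≡1+2positiveCount : q ≡ positiveCount ℕ.* 2 ℕ.+ 1
    q≡1+2positiveCount = ≡R.begin
      q                                         ≡R.≡⟨ count-all U? (λ _ → tt) ⟨
      count (U? {A = Fin q})
        ≡R.≡⟨ count-involution U? negate negate-involutive (λ _ _ → tt) ⟩
      count (λ i → U? i ×-dec i Finₚ.<? negate i) ℕ.* 2 ℕ.+ count (λ i → U? i ×-dec negate i Finₚ.≟ i)
        ≡R.≡⟨ ≡.cong₂ (λ k l → k ℕ.* 2 ℕ.+ l)
               (count-cong (λ i → U? i ×-dec i Finₚ.<? negate i) (λ i → positive? (from i))
                 (λ i (_ , i<) → ≡.subst (Fin._< negate i) (≡.sym (strictlyInverseˡ i)) i<)
                 (λ i i< → tt , ≡.subst (Fin._< negate i) (strictlyInverseˡ i) i<))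
               (count-unique (λ i → U? i ×-dec negate i Finₚ.≟ i) (to 0#)
                 (tt , fixed-onIndex neg (trans (-‿cong (strictlyInverseʳ 0#))
                       (trans -0#≈0# (sym (strictlyInverseʳ 0#)))))
                 (λ i (_ , eq) → from-injective
                       (trans (x≈-x⇒x≈0 (sym (onIndex-fixed neg eq))) (sym (strictlyInverseʳ 0#))))) ⟩
      positiveCount ℕ.* 2 ℕ.+ 1 ≡R.∎
      where
      neg : Carrier → Carrier
      neg x = - x
      negate : Fin q → Fin q
      negate = onIndex neg
      negate-involutive : ∀ i → negate (negate i) ≡ i
      negate-involutive = onIndex-involutive neg -‿cong -‿involutive

    -- The parity of (q - 1)/2 is that of the number of fixed points of x ↦ ± τ x
    -- on the positive elements.
    module Folded (τ : Carrier → Carrier) (τ-cong : ∀ {x y} → x ≈ y → τ x ≈ τ y)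
      (τ≉0 : ∀ {x} → x ≉ 0# → τ x ≉ 0#) (τ-odd : ∀ x → τ (- x) ≈ - τ x)
      (ττ : ∀ x → τ (τ x) ≈ x ⊎ τ (τ x) ≈ - x) where

      -- The map induced by τ on the pairs {x, -x}, read on their positive members. Elsewhere it is
      -- the identity, since `count-involution` asks for an involution of the whole index set.
      folded : Carrier → Carrier
      folded x with positive? x
      ... | yes _ = abs (τ x)
      ... | no _  = x

      folded-positive : ∀ {x} → Positive x → folded x ≡ abs (τ x)
      folded-positive {x} x>0 with positive? x
      ... | yes _  = ≡.refl
      ... | no x≯0 = contradiction x>0 x≯0

      folded-¬positive : ∀ {x} → ¬ Positive x → folded x ≡ x
      folded-¬positive {x} x≯0 with positive? x
      ... | yes x>0 = contradiction x>0 x≯0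
      ... | no _    = ≡.refl

      folded-preserves : ∀ {x} → Positive x → Positive (folded x)
      folded-preserves x>0 = ≡.subst Positive (≡.sym (folded-positive x>0))
            (abs-positive (τ≉0 (positive⇒≉0 x>0)))

      τ± : ∀ {x y} → x ≈ y ⊎ x ≈ - y → τ x ≈ τ y ⊎ τ x ≈ - τ y
      τ± (inj₁ x≈y)  = inj₁ (τ-cong x≈y)
      τ± {y = y} (inj₂ x≈-y) = inj₂ (trans (τ-cong x≈-y) (τ-odd y))

      ±-trans : ∀ {x y z} → x ≈ y ⊎ x ≈ - y → y ≈ z ⊎ y ≈ - z → x ≈ z ⊎ x ≈ - z
      ±-trans (inj₁ x≈y)  y≈±z = Sum.map (trans x≈y) (trans x≈y) y≈±z
      ±-trans (inj₂ x≈-y) (inj₁ y≈z)  = inj₂ (trans x≈-y (-‿cong y≈z))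
      ±-trans (inj₂ x≈-y) (inj₂ y≈-z) = inj₁ (trans x≈-y (trans (-‿cong y≈-z) (-‿involutive _)))

      folded-cong : ∀ {x y} → x ≈ y → folded x ≈ folded y
      folded-cong {x} {y} x≈y with positive? y
      ... | yes y>0 = trans (reflexive (folded-positive (Positive-resp (sym x≈y) y>0)))
        (±⇒abs≈ (abs-positive (τ≉0 (positive⇒≉0 y>0)))
          (±-trans (inj₁ (τ-cong x≈y)) (Sum.map sym (λ eq → trans (sym (-‿involutive _)) (-‿cong (sym eq)))
                (abs≈± (τ y)))))
      ... | no y≯0  = trans (reflexive (folded-¬positive (λ x>0 → y≯0 (Positive-resp x≈y x>0)))) x≈y

      -- On a positive x, oddness moves the inner sign outside τ, so the second application yields
      -- the positive one of ± τ (τ x), that is, of ± x.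
      folded-involutive : ∀ x → folded (folded x) ≈ x
      folded-involutive x = byCases (positive? x)
        where
        byCases : Dec (Positive x) → folded (folded x) ≈ x
        byCases (yes x>0) = begin
          folded (folded x)     ≡⟨ folded-positive (folded-preserves x>0) ⟩
          abs (τ (folded x))    ≡⟨ ≡.cong (λ y → abs (τ y)) (folded-positive x>0) ⟩
          abs (τ (abs (τ x)))   ≈⟨ ±⇒abs≈ x>0 (±-trans (τ± (abs≈± (τ x))) (ττ x)) ⟩
          x                     ∎
        byCases (no x≯0) = reflexive (≡.trans (≡.cong folded (folded-¬positive x≯0)) (folded-¬positive x≯0))

      fixed? : Decidable (λ i → Positive (from i) × onIndex folded i ≡ i)
      fixed? i = positive? (from i) ×-dec onIndex folded i Finₚ.≟ i

      half : ℕ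
      half = count (λ i → positive? (from i) ×-dec i Finₚ.<? onIndex folded i)

      positiveCount≡2half+fixed : positiveCount ≡ half ℕ.* 2 ℕ.+ count fixed?
      positiveCount≡2half+fixed = count-involution (λ i → positive? (from i)) (onIndex folded)
        (onIndex-involutive folded folded-cong folded-involutive)
        (λ i i>0 → Positive-resp (sym (strictlyInverseʳ _)) (folded-preserves i>0))

      fixed⇒± : ∀ {i} → Positive (from i) → onIndex folded i ≡ i →
                τ (from i) ≈ from i ⊎ τ (from i) ≈ - from i
      fixed⇒± {i} i>0 eq with abs≈± (τ (from i))
                            | trans (reflexive (≡.sym (folded-positive i>0))) (onIndex-fixed folded eq)
      ... | inj₁ abs≈τ  | abs≈i = inj₁ (trans (sym abs≈τ) abs≈i)
      ... | inj₂ abs≈-τ | abs≈i = inj₂ (trans (sym (-‿involutive _)) (-‿cong (trans (sym abs≈-τ) abs≈i)))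

      ±⇒fixed : ∀ {i} → Positive (from i) → τ (from i) ≈ from i ⊎ τ (from i) ≈ - from i →
                onIndex folded i ≡ i
      ±⇒fixed i>0 τ± = fixed-onIndex folded (trans (reflexive (folded-positive i>0)) (±⇒abs≈ i>0 τ±))

    -- Multiplication by i fixes no pair {x, -x} with x ≠ 0, since i x = ± x would give x = i² x =
    -- -x. Hence (q - 1)/2 is even.
    √-1⇒q%4≡1 : ∀ i → i * i ≈ - 1# → q ℕ.% 4 ≡ 1
    √-1⇒q%4≡1 i ii≈-1 = ≡.trans (≡.cong (ℕ._% 4) q≡1+4half) ([m+kn]%n≡m%n 1 half 4)
      where
      i≉0 : i ≉ 0#
      i≉0 i≈0 = -1≉0 (trans (sym ii≈-1) (trans (*-congʳ i≈0) (zeroˡ i)))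
      iix≈-x : ∀ x → i * (i * x) ≈ - x
      iix≈-x x = begin
        i * (i * x)  ≈⟨ *-assoc i i x ⟨
        i * i * x    ≈⟨ *-congʳ ii≈-1 ⟩
        - 1# * x     ≈⟨ solve 1 (λ x → (:- :1) :* x := :- x) refl x ⟩
        - x          ∎
      i*-x≈-ix : ∀ x → i * - x ≈ - (i * x)
      i*-x≈-ix x = solve 2 (λ i x → i :* (:- x) := :- (i :* x)) refl i x
      open Folded (i *_) *-congˡ (λ x≉0 ix≈0 → x≉0 (x≉0∧xy≈0⇒y≈0 i≉0 ix≈0)) i*-x≈-ix (λ x → inj₂ (iix≈-x x))
      ix≈±x⇒x≈-x : ∀ x → i * x ≈ x ⊎ i * x ≈ - x → x ≈ - x
      ix≈±x⇒x≈-x x (inj₁ ix≈x) = begin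
        x            ≈⟨ ix≈x ⟨
        i * x        ≈⟨ *-congˡ ix≈x ⟨
        i * (i * x)  ≈⟨ iix≈-x x ⟩
        - x          ∎
      ix≈±x⇒x≈-x x (inj₂ ix≈-x) = begin
        x            ≈⟨ -‿involutive x ⟨
        - - x        ≈⟨ -‿cong ix≈-x ⟨
        - (i * x)    ≈⟨ i*-x≈-ix x ⟨
        i * - x      ≈⟨ *-congˡ ix≈-x ⟨
        i * (i * x)  ≈⟨ iix≈-x x ⟩
        - x          ∎
      noFixed : count fixed? ≡ 0
      noFixed = count-none fixed? (λ k (k>0 , eq) →
        positive⇒≉0 k>0 (x≈-x⇒x≈0 (ix≈±x⇒x≈-x (from k) (fixed⇒± k>0 eq))))
      q≡1+4half : q ≡ 1 ℕ.+ half ℕ.* 4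
      q≡1+4half = ≡R.begin
        q                                 ≡R.≡⟨ q≡1+2positiveCount ⟩
        positiveCount ℕ.* 2 ℕ.+ 1
          ≡R.≡⟨ ≡.cong (λ k → k ℕ.* 2 ℕ.+ 1)
                (≡.trans positiveCount≡2half+fixed (≡.cong (half ℕ.* 2 ℕ.+_) noFixed)) ⟩
        (half ℕ.* 2 ℕ.+ 0) ℕ.* 2 ℕ.+ 1
          ≡R.≡⟨ ℕsolve 1 (λ h → (h ℕ:* ℕcon 2 ℕ:+ ℕcon 0) ℕ:* ℕcon 2 ℕ:+ ℕcon 1 ℕ:=
                ℕcon 1 ℕ:+ h ℕ:* ℕcon 4) ≡.refl half ⟩
        1 ℕ.+ half ℕ.* 4                  ≡R.∎

    -- Without a root of -1, inversion fixes just the pair {1, -1}: x⁻¹ = x means x = ± 1, and x⁻¹ =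
    -- -x would mean x² = -1. Then (q - 1)/2 is odd and q leaves remainder 3.
    q%4≡1⇒√-1 : q ℕ.% 4 ≡ 1 → ∃[ i ] i * i ≈ - 1#
    q%4≡1⇒√-1 q%4≡1 with search {P = λ i → i * i ≈ - 1#}
          (λ x≈y xx≈-1 → trans (*-cong (sym x≈y) (sym x≈y)) xx≈-1) (λ i → i * i ≟ - 1#)
    ... | yes √-1 = √-1
    ... | no ∄√-1 = contradiction (≡.trans (≡.sym q%4≡1) q%4≡3) λ ()
      where
      recip : Carrier → Carrier
      recip x with zero⊎unit x
      -- With 0 sent to 0, inversion is odd and involutive on the whole field, as `Folded` requires.
      ... | inj₁ _       = 0#
      ... | inj₂ (y , _) = y
      recip-inverse : ∀ {x} → x ≉ 0# → recip x * x ≈ 1#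
      recip-inverse {x} x≉0 with zero⊎unit x
      ... | inj₁ x≈0        = contradiction x≈0 x≉0
      ... | inj₂ (_ , yx≈1) = yx≈1
      recip-zero : ∀ {x} → x ≈ 0# → recip x ≈ 0#
      recip-zero {x} x≈0 with zero⊎unit x
      ... | inj₁ _          = refl
      ... | inj₂ (y , yx≈1) = contradiction (trans (sym yx≈1) (trans (*-congˡ x≈0) (zeroʳ y))) 1≉0
      recip-≉0 : ∀ {x} → x ≉ 0# → recip x ≉ 0#
      recip-≉0 {x} x≉0 rx≈0 = 1≉0 (trans (sym (recip-inverse x≉0)) (trans (*-congʳ rx≈0) (zeroˡ x)))
      -x≉0 : ∀ {x} → x ≉ 0# → - x ≉ 0#
      -x≉0 x≉0 -x≈0 = x≉0 (trans (sym (-‿involutive _)) (trans (-‿cong -x≈0) -0#≈0#))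
      recip-cong : ∀ {x y} → x ≈ y → recip x ≈ recip y
      recip-cong {x} {y} x≈y with y ≟ 0#
      ... | yes y≈0 = trans (recip-zero (trans x≈y y≈0)) (sym (recip-zero y≈0))
      ... | no y≉0  = inverse-unique (recip-inverse (λ x≈0 → y≉0 (trans (sym x≈y) x≈0)))
        (trans (*-congˡ x≈y) (recip-inverse y≉0))
      recip-odd : ∀ x → recip (- x) ≈ - recip x
      recip-odd x with x ≟ 0#
      ... | yes x≈0 = trans (recip-zero (trans (-‿cong x≈0) -0#≈0#))
        (trans (sym -0#≈0#) (-‿cong (sym (recip-zero x≈0))))
      ... | no x≉0  = inverse-unique (recip-inverse (-x≉0 x≉0))
        (trans (solve 2 (λ r x → (:- r) :* (:- x) := r :* x) refl (recip x) x) (recip-inverse x≉0))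
      recip-recip : ∀ x → recip (recip x) ≈ x
      recip-recip x with x ≟ 0#
      ... | yes x≈0 = trans (recip-zero (recip-zero x≈0)) (sym x≈0)
      ... | no x≉0  = inverse-unique (recip-inverse (recip-≉0 x≉0))
            (trans (*-comm x (recip x)) (recip-inverse x≉0))
      open Folded recip recip-cong recip-≉0 recip-odd (λ x → inj₁ (recip-recip x))
      xx≈1⇒recip≈x : ∀ {x} → x * x ≈ 1# → recip x ≈ x
      xx≈1⇒recip≈x {x} xx≈1 = inverse-unique (recip-inverse x≉0) xx≈1
        where
        x≉0 : x ≉ 0#
        x≉0 x≈0 = 1≉0 (trans (sym xx≈1) (trans (*-congˡ x≈0) (zeroʳ x)))
      recip≈±⇒1≈± : ∀ {x} → x ≉ 0# → recip x ≈ x ⊎ recip x ≈ - x → 1# ≈ x ⊎ 1# ≈ - x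
      recip≈±⇒1≈± {x} x≉0 (inj₁ rx≈x) = x²≈y²⇒x≈±y 1# x (begin
        1# * 1#      ≈⟨ *-identityʳ 1# ⟩
        1#           ≈⟨ recip-inverse x≉0 ⟨
        recip x * x  ≈⟨ *-congʳ rx≈x ⟩
        x * x        ∎)
      recip≈±⇒1≈± {x} x≉0 (inj₂ rx≈-x) = contradiction (x , (begin
        x * x          ≈⟨ solve 1 (λ x → x :* x := :- ((:- x) :* x)) refl x ⟩
        - (- x * x)    ≈⟨ -‿cong (*-congʳ rx≈-x) ⟨
        - (recip x * x) ≈⟨ -‿cong (recip-inverse x≉0) ⟩
        - 1#           ∎)) ∄√-1
      -- Whether 1 or -1 counts as positive depends on the enumeration.
      |1| : Fin q
      |1| = to (abs 1#)
      from|1|≈abs1 : from |1| ≈ abs 1#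
      from|1|≈abs1 = strictlyInverseʳ (abs 1#)
      |1|>0 : Positive (from |1|)
      |1|>0 = Positive-resp (sym from|1|≈abs1) (abs-positive 1≉0)
      x≈±1⇒xx≈1 : ∀ {x} → x ≈ 1# ⊎ x ≈ - 1# → x * x ≈ 1#
      x≈±1⇒xx≈1 (inj₁ x≈1) = trans (*-cong x≈1 x≈1) (*-identityʳ 1#)
      x≈±1⇒xx≈1 (inj₂ x≈-1) = trans (*-cong x≈-1 x≈-1) (solve 0 ((:- :1) :* (:- :1) := :1) refl)
      oneFixed : count fixed? ≡ 1
      oneFixed = count-unique fixed? |1|
        (|1|>0 , ±⇒fixed |1|>0 (inj₁ (xx≈1⇒recip≈x
              (x≈±1⇒xx≈1 (Sum.map (trans from|1|≈abs1) (trans from|1|≈abs1) (abs≈± 1#))))))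
        (λ k (k>0 , eq) → from-injective (trans
          (sym (±⇒abs≈ k>0 (recip≈±⇒1≈± (positive⇒≉0 k>0) (fixed⇒± k>0 eq)))) (sym from|1|≈abs1)))
      q≡3+4half : q ≡ 3 ℕ.+ half ℕ.* 4
      q≡3+4half = ≡R.begin
        q                                 ≡R.≡⟨ q≡1+2positiveCount ⟩
        positiveCount ℕ.* 2 ℕ.+ 1
          ≡R.≡⟨ ≡.cong (λ k → k ℕ.* 2 ℕ.+ 1)
                (≡.trans positiveCount≡2half+fixed (≡.cong (half ℕ.* 2 ℕ.+_) oneFixed)) ⟩
        (half ℕ.* 2 ℕ.+ 1) ℕ.* 2 ℕ.+ 1
          ≡R.≡⟨ ℕsolve 1 (λ h → (h ℕ:* ℕcon 2 ℕ:+ ℕcon 1) ℕ:* ℕcon 2 ℕ:+ ℕcon 1 ℕ:=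
                ℕcon 3 ℕ:+ h ℕ:* ℕcon 4) ≡.refl half ⟩
        3 ℕ.+ half ℕ.* 4                  ≡R.∎
      q%4≡3 : q ℕ.% 4 ≡ 3
      q%4≡3 = ≡.trans (≡.cong (ℕ._% 4) q≡3+4half) ([m+kn]%n≡m%n 3 half 4)

    -- The squares x² and the differences c - y² fill (q + 1)/2 values each,
    -- so they meet.  Nonnegative elements index the former and the negative
    -- ones, together with an extra copy of 0, the latter.
    sum-of-two-squares : ∀ c → ∃[ x ] ∃[ y ] x * x + y * y ≈ c
    sum-of-two-squares c = collide (Finₚ.pigeonhole (ℕₚ.n<1+n q) value)
      where
      Negative : Carrier → Set
      Negative x = to (- x) Fin.< to x
      negative? : Decidable Negative
      negative? x = to (- x) Finₚ.<? to x
      value : Fin (suc q) → Fin q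
      -- This is c - 0², from the extra copy of 0.
      value zero = to c
      value (suc k) with negative? (from k)
      ... | yes _ = to (c - from k * from k)
      ... | no _  = to (from k * from k)
      x²≈c-y²⇒ : ∀ {x y} → x * x ≈ c - y * y → x * x + y * y ≈ c
      x²≈c-y²⇒ {x} {y} eq = trans (+-congʳ eq) (solve 2 (λ c z → c :- z :+ z := c) refl c (y * y))
      c-x²≈c-y²⇒ : ∀ {x y} → c - x * x ≈ c - y * y → x * x ≈ y * y
      c-x²≈c-y²⇒ {x} {y} eq = begin
        x * x            ≈⟨ solve 2 (λ c z → z := c :- (c :- z)) refl c (x * x) ⟩
        c - (c - x * x)  ≈⟨ +-congˡ (-‿cong eq) ⟩
        c - (c - y * y)  ≈⟨ solve 2 (λ c z → z := c :- (c :- z)) refl c (y * y) ⟨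
        y * y            ∎
      negative-neg : ∀ {x y} → x ≈ - y → Negative x → to y Fin.< to (- y)
      negative-neg x≈-y = ≡.subst₂ Fin._<_ (to-cong (trans (-‿cong x≈-y) (-‿involutive _))) (to-cong x≈-y)
      collide : (∃[ i ] ∃[ j ] i Fin.< j × value i ≡ value j) → ∃[ x ] ∃[ y ] x * x + y * y ≈ c
      collide (zero , zero , () , _)
      collide (suc _ , zero , () , _)
      -- Were k negative, c - k² = c would give k = 0, which is not negative. So k² = c.
      collide (zero , suc k , _ , eq) with negative? (from k)
      ... | no _ = from k , 0# , trans (+-cong (sym (to-injective eq)) (zeroʳ 0#)) (+-identityʳ c)
      ... | yes k<0 = contradiction k<0 (Finₚ.<-irrefl (to-cong (trans (-‿cong k≈0) (trans -0#≈0# (sym k≈0)))))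
        where
        k≈0 : from k ≈ 0#
        k≈0 = Sum.[ (λ eq → eq) , (λ eq → trans eq -0#≈0#) ] (x²≈y²⇒x≈±y (from k) 0# (begin
          from k * from k
            ≈⟨ c-x²≈c-y²⇒ (trans (sym (to-injective eq)) (solve 1 (λ c → c := c :- :0 :* :0) refl c)) ⟩
          0# * 0#                      ∎))
      collide (suc k , suc l , k<l , eq) with negative? (from k) | negative? (from l)
      ... | no _    | yes _   = from k , from l , x²≈c-y²⇒ (to-injective eq)
      ... | yes _   | no _    = from l , from k , x²≈c-y²⇒ (sym (to-injective eq))
      -- Equal squares give k = ± l, but the indices differ and -l is not negative.
      ... | yes k<0 | yes l<0 with x²≈y²⇒x≈±y (from k) (from l) (c-x²≈c-y²⇒ (to-injective eq))
      ...   | inj₁ k≈l  = contradiction k<l (Finₚ.<-irrefl (≡.cong suc (from-injective k≈l)))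
      ...   | inj₂ k≈-l = contradiction (negative-neg k≈-l k<0) (Finₚ.<-asym l<0)
      collide (suc k , suc l , k<l , eq) | no k≮0 | no l≮0 with x²≈y²⇒x≈±y (from k) (from l) (to-injective eq)
      ...   | inj₁ k≈l  = contradiction k<l (Finₚ.<-irrefl (≡.cong suc (from-injective k≈l)))
      ...   | inj₂ k≈-l = contradiction k<l (Finₚ.<-irrefl (≡.cong suc (from-injective k≈l)))
        where
        -- As neither k nor l = -k is negative, neither precedes the other in the enumeration, so
        -- they coincide, against the distinct indices.
        -l≮l : to (from k) Fin.≮ to (from l)
        -l≮l = λ k<l → l≮0 (≡.subst (Fin._< to (from l)) (to-cong k≈-l) k<l)
        l≮k : to (from l) Fin.≮ to (from k)
        l≮k = λ l<k → k≮0 (≡.subst (Fin._< to (from k))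
              (to-cong (trans (sym (-‿involutive _)) (-‿cong (sym k≈-l)))) l<k)
        k≈l : from k ≈ from l
        k≈l with Finₚ.<-cmp (to (from k)) (to (from l))
        ... | tri< k<l _ _ = contradiction k<l -l≮l
        ... | tri≈ _ k≡l _ = to-injective k≡l
        ... | tri> _ _ l<k = contradiction l<k l≮k

2∣n⊎2∣1+n : ∀ n → 2 ∣ n ⊎ 2 ∣ suc n
2∣n⊎2∣1+n zero    = inj₁ (divides 0 ≡.refl)
2∣n⊎2∣1+n (suc n) = Sum.swap (Sum.map₁ (λ 2∣n → ∣m∣n⇒∣m+n n∣n 2∣n) (2∣n⊎2∣1+n n))

-- Finite Heyting fields and the two directions of the equivalence.

module _ {c ℓ₁ ℓ₂} (F : HeytingField c ℓ₁ ℓ₂) (q : ℕ) (card : OverField.HasCardinality F q) where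

  open OverField F using (commutativeRing; Point; Q; _-ᵖ_; ContainsEquilateral; HasCharacteristic; module D)
  open CommutativeRing commutativeRing hiding (zero)
  open HeytingField F using (#⇒invertible; invertible⇒#; tight)
  open FiniteRing commutativeRing q card using (_≟_; search)
  open import Relation.Binary.Reasoning.Setoid setoid

  x-0≈x : ∀ x → x - 0# ≈ x
  x-0≈x x = solve 1 (λ x → x :- :0 := x) refl x
    where open IntegerSolver commutativeRing

  1≉0ᶠ : 1# ≉ 0#
  1≉0ᶠ 1≈0 = proj₂ (tight 1# 0#) 1≈0 (invertible⇒#
    (1# , trans (*-identityˡ _) (x-0≈x 1#) , trans (*-identityʳ _) (x-0≈x 1#)))

  -- A finite search decides whether x is invertible. If it is not, x cannot be apart from 0, and
  -- tightness gives x ≈ 0.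
  zero⊎unitᶠ : ∀ x → x ≈ 0# ⊎ ∃[ y ] y * x ≈ 1#
  zero⊎unitᶠ x with search {P = λ y → y * x ≈ 1#} (λ y≈z yx≈1 → trans (*-congʳ (sym y≈z)) yx≈1)
        (λ y → y * x ≟ 1#)
  ... | yes unit  = inj₂ unit
  ... | no ¬unit  = inj₁ (proj₁ (tight x 0#) λ x#0 →
    let y , y[x-0]≈1 , _ = #⇒invertible x#0
    in ¬unit (y , trans (*-congˡ (sym (x-0≈x x))) y[x-0]≈1))

  isDiscreteField : IsDiscreteField commutativeRing
  isDiscreteField = record { 1≉0 = 1≉0ᶠ ; zero⊎unit = zero⊎unitᶠ }

  open DiscreteField commutativeRing isDiscreteField
  open FiniteField commutativeRing isDiscreteField q card

  Q≈sqDist : ∀ {d} (x y : Point d) → Q (x -ᵖ y) ≈ sqDist x y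
  -- The square `z D.^ 2` unfolds to `z * (z * 1#)`.
  Q≈sqDist x y = sum-cong-≋ (λ i → *-congˡ {x i - y i} (*-identityʳ (x i - y i)))

  module _ (q-odd : Odd q) (p : ℕ) (char : HasCharacteristic p) (d : ℕ) where

    1+1≉0 : 1# + 1# ≉ 0#
    1+1≉0 = odd⇒1+1≉0 q-odd

    open OddCharacteristic 1+1≉0

    n : ℕ
    n = suc (suc d)

    equilateral⇒ : ContainsEquilateral d n → (p ∣ n) × (Odd d ⊎ q % 4 ≡ 1)
    equilateral⇒ (P , Δ , Δ≉0 , equilateral) = p∣n , oddOrSquare
      where
      half : ∃[ h ] h * (1# + 1#) ≈ 1#
      half = inverse 1+1≉0
      h = proj₁ half
      -- Half of Δ, because `lift-orthogonal` expects the common squared distance as 2C.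
      C = h * Δ
      2C≈Δ : (1# + 1#) * C ≈ Δ
      2C≈Δ = begin
        (1# + 1#) * (h * Δ)  ≈⟨ solve 2 (λ h Δ → (:1 :+ :1) :* (h :* Δ) := h :* (:1 :+ :1) :* Δ) refl h Δ ⟩
        h * (1# + 1#) * Δ    ≈⟨ *-congʳ (proj₂ half) ⟩
        1# * Δ               ≈⟨ *-identityˡ Δ ⟩
        Δ                    ∎
      C≉0 : C ≉ 0#
      C≉0 C≈0 = Δ≉0 (trans (sym 2C≈Δ) (trans (*-congˡ C≈0) (zeroʳ _)))
      f : Fin n → Vector Carrier n
      f j = lift h (proj₂ half) C (P j)
      f⊥ : OrthogonalOfNorm (- 1#) C f
      f⊥ = lift-orthogonal h (proj₂ half) C P
        (λ j k j≢k → trans (sym (Q≈sqDist (P j) (P k))) (trans (equilateral j k j≢k) (sym 2C≈Δ)))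
      size≈0 : sum {n} (λ _ → 1#) ≈ 0#
      size≈0 = orthogonal-pole⇒size≈0 (- 1#) C C≉0 f f⊥
        pole (form-pole-pole {d})
        (λ k → form-lift-pole h (proj₂ half) C (P k))
      p∣n : p ∣ n
      p∣n = Equivalence.to (char n) (trans (sym (sum-replicate n)) size≈0)
      oddOrSquare : Odd d ⊎ q % 4 ≡ 1
      oddOrSquare with 2 ∣? d
      ... | no d-odd = inj₁ d-odd
      ... | yes 2∣d  =
        let C⁻¹ , C⁻¹C≈1     = inverse C≉0
            r , s , rr+ss≈C⁻¹ = sum-of-two-squares C⁻¹
            -- The d + 2 vectors form pairs because d is even, and r² + s² = C⁻¹ brings their norm
            -- from C to 1.
            g , g⊥           = renorm (- 1#) C r s (∣m∣n⇒∣m+n n∣n 2∣d) f f⊥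
            i , ii≈-1        = orthonormal⇒square 1+1≉0 (- 1#) g
              (OrthogonalOfNorm-cong (- 1#) g (trans (*-congʳ rr+ss≈C⁻¹) C⁻¹C≈1) g⊥)
        in inj₂ (√-1⇒q%4≡1 i ii≈-1)

    equilateral⇐ : (p ∣ n) × (Odd d ⊎ q % 4 ≡ 1) → ContainsEquilateral d n
    equilateral⇐ (p∣n , oddOrSquare) =
      let g , g⊥          = antibasis oddOrSquare
          P , equilateral = antibasis⇒equilateral 1+1≉0 g g⊥ size≈0
      -- The common squared distance -2 comes from `shifted-gram⇒equilateral`; it is nonzero because
      -- 2 is.
      in P , - (1# + 1#) , -[1+1]≉0 ,
         λ j k j≢k → trans (Q≈sqDist (P j) (P k)) (equilateral j k j≢k)
      where
      size≈0 : sum {n} (λ _ → 1#) ≈ 0#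
      size≈0 = trans (sum-replicate n) (Equivalence.from (char n) p∣n)
      -[1+1]≉0 : - (1# + 1#) ≉ 0#
      -[1+1]≉0 eq = 1+1≉0 (trans (solve 0 (:1 :+ :1 := :- (:- (:1 :+ :1))) refl) (trans (-‿cong eq) -0#≈0#))
      antibasis : Odd d ⊎ q % 4 ≡ 1 →
                  Σ[ g ∈ (Fin (suc d) → Vector Carrier (suc d)) ] OrthogonalOfNorm 1# (- 1#) g
      antibasis (inj₂ q%4≡1) =
        let i , ii≈-1 = q%4≡1⇒√-1 q%4≡1
        in antibasis-square i ii≈-1
      antibasis (inj₁ d-odd) with 2∣n⊎2∣1+n d
      ... | inj₁ 2∣d   = contradiction 2∣d d-odd
      ... | inj₂ 2∣1+d =
        let r , s , rr+ss≈-1 = sum-of-two-squares (- 1#)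
        in antibasis-even r s rr+ss≈-1 2∣1+d

    containsEquilateral⇔ : ContainsEquilateral d n ⇔ ((p ∣ n) × (Odd d ⊎ q % 4 ≡ 1))
    containsEquilateral⇔ = mk⇔ equilateral⇒ equilateral⇐

open import Data.Nat.Base using (_+_)

proposition4p4 : ∀ {c ℓ₁ ℓ₂} (F : HeytingField c ℓ₁ ℓ₂) (q p d : ℕ) →
    IsPrimePower q → Odd q →
    OverField.HasCardinality F q →
    OverField.HasCharacteristic F p →
    1 ≤ d →
    OverField.ContainsEquilateral F d (d + 2) ⇔ ((p ∣ d + 2) × (Odd d ⊎ q % 4 ≡ 1))
proposition4p4 F q p d _ q-odd card char _ =
  -- The lifts add two coordinates in front of those of Fᵈ, so the equivalence is proved at
  -- `suc (suc d)` and transported along 2 + d = d + 2.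
  ≡.subst (λ n → OverField.ContainsEquilateral F d n ⇔ ((p ∣ n) × (Odd d ⊎ q % 4 ≡ 1)))
    (ℕₚ.+-comm 2 d) (containsEquilateral⇔ F q card q-odd p char d)
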